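{- For every constant integer $d\ge 1$ there is a constant $\varepsilon_d\in(0,1]$ such that any $\mathrm{Res}(d)$ refutation of $d\text{ - }\mathrm{RLNP}_n$ is of size $2^{\Omega(n^{\varepsilon_d})}$; that is, for each $d\ge1$ there are constants $\varepsilon_d\in(0,1]$ and $c_d>0$ such that for all sufficiently large $n$ every $\mathrm{Res}(d)$ refutation of $d\text{ - }\mathrm{RLNP}_n$ has size at least $2^{c_d n^{\varepsilon_d}}$.
   Context: Notation: $[n]=\{1,\dots,n\}$. A literal is a propositional variable or its negation. A $d$-conjunction is a conjunction of at most $d$ literals; a $d$-DNF is a disjunction of arbitrarily many $d$-conjunctions. A clause is a disjunction of literals (so it is a $d$-DNF for every $d\ge 1$). The system $\mathrm{Res}(d)$ ($d\ge1$). Lines are $d$-DNFs. Rules ($\mathcal P,\mathcal Q$ are $d$-DNFs, the $\ell_i$ are literals, and all conjunctions have at most $d$ literals): ($\wedge$-introduction) from $\mathcal P\vee\bigwedge_{i\in I_1}\ell_i$ and $\mathcal Q\vee\bigwedge_{i\in I_2}\ell_i$ derive $\mathcal P\vee\mathcal Q\vee\bigwedge_{i\in I_1\cup I_2}\ell_i$, provided $|I_1\cup I_2|\le d$; (cut) from $\mathcal P\vee\bigvee_{i\in I}\ell_i$ and $\mathcal Q\vee\bigwedge_{i\in I}\neg\ell_i$ derive $\mathcal P\vee\mathcal Q$; (weakening 1) from $\mathcal P$ derive $\mathcal P\vee\bigwedge_{i\in I}\ell_i$, provided $|I|\le d$; (weakening 2) from $\mathcal P\vee\bigwedge_{i\in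 I_1\cup I_2}\ell_i$ derive $\mathcal P\vee\bigwedge_{i\in I_1}\ell_i$. A $\mathrm{Res}(d)$ refutation of a set of clauses is a derivation of the empty clause from these clauses (axioms), viewed as a directed acyclic graph whose sources are axioms and whose only sink is the empty clause. Its size is the number of internal nodes, i.e. the number of rule applications. The contradiction $d\text{ - }\mathrm{RLNP}_n$ ($d$-relativized Least number principle). Variables: $L_{i,j}$, $S_{i,j}$ for $i,j\in[n]$, and $R^p_i$ for $i\in[n]$, $p\in[d]$. Write $\mathcal R_i$ for $\bigwedge_{p\in[d]}R^p_i$, so that $\neg\mathcal R_i$ abbreviates $\bigvee_{p\in[d]}\neg R^p_i$. The clauses are: $\neg\mathcal R_i\vee\neg L_{i,i}$ for $i\in[n]$; $\neg\mathcal R_i\vee\neg\mathcal R_j\vee\neg\mathcal R_\ell\vee\neg L_{i,j}\vee\neg L_{j,\ell}\vee L_{i,\ell}$ for $i,j,\ell\in[n]$; $\bigvee_{i\in[n]}S_{i,j}$ for $j\in[n]$; $\neg S_{i,j}\vee\neg\mathcal R_j\vee R^p_i$ for $i,j\in[n]$, $p\in[d]$; $\neg S_{i,j}\vee\neg\mathcal R_j\vee L_{i,j}$ for $i,j\in[n]$; $R^p_n$ for $p\in[d]$. -}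

module Defs where

open import Data.Fin.Base as Fin using (Fin; toℕ)
open import Data.Integer.Base using (∣_∣)
open import Data.List.Base using (List; []; _∷_; [_]; _++_; map; length; allFin)
open import Data.List.Membership.Propositional using (_∈_)
open import Data.List.Relation.Binary.BagAndSetEquality using (_∼[_]_; [_]-Equality; set)
open import Data.List.Relation.Binary.Pointwise.Base using (Pointwise)
import Data.List.Relation.Binary.Subset.Setoid as Subset
open import Data.List.Relation.Unary.All using (All)
open import Data.Nat.Base using (ℕ; suc; NonZero; _*_; _^_; _≤_)
open import Data.Product.Base using (∃; ∃-syntax; ∃₂; _×_; proj₁)
open import Data.Rational.Base using (ℚ; ↥_; ↧ₙ_)
open import Data.Sum.Base using (_⊎_; inj₁; inj₂; [_,_]′)
open import Level using (0ℓ)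
open import Relation.Binary.PropositionalEquality using (_≡_)
open import Relation.Unary using (Pred)

infix 4 _≈_

data Literal (V : Set) : Set where
  pos neg : V → Literal V

negate : ∀ {V} → Literal V → Literal V
negate (pos x) = neg x
negate (neg x) = pos x

-- Conjunctions, disjunctions and clauses are lists standing for finite sets:
-- order and repetitions are irrelevant (see _≈_ and HasWidth≤).

Clause Conjunction DNF : Set → Set
Clause      V = List (Literal V)
Conjunction V = List (Literal V)
DNF         V = List (Conjunction V)

-- [] is the empty disjunction, i.e. the empty clause.
clause : ∀ {V} → Clause V → DNF V
clause = map [_]

-- Equality as sets of sets of literals.
_≈_ : ∀ {V} → DNF V → DNF V → Set
_≈_ {V} P Q = P ⊆ Q × Q ⊆ P
  where open Subset ([ set ]-Equality (Literal V)) using (_⊆_)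

-- At most d distinct literals.
HasWidth≤ : ∀ {V} → ℕ → Conjunction V → Set
HasWidth≤ d C = ∃[ D ] C ∼[ set ] D × length D ≤ d

IsDNF : ∀ {V} → ℕ → DNF V → Set
IsDNF d = All (HasWidth≤ d)

-- The rules on representatives. That all formulas involved are d-DNFs is
-- imposed on the lines of a refutation.
data Rule {V : Set} (d : ℕ) : List (DNF V) → DNF V → Set where

  ∧-introduction : ∀ P Q C₁ C₂ → HasWidth≤ d (C₁ ++ C₂) →
    Rule d ((P ++ [ C₁ ]) ∷ (Q ++ [ C₂ ]) ∷ []) (P ++ Q ++ [ C₁ ++ C₂ ])

  cut : ∀ P Q (ℓs : List (Literal V)) →
    Rule d ((P ++ clause ℓs) ∷ (Q ++ [ map negate ℓs ]) ∷ []) (P ++ Q)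

  weakening₁ : ∀ P C → HasWidth≤ d C →
    Rule d (P ∷ []) (P ++ [ C ])

  weakening₂ : ∀ P C₁ C₂ →
    Rule d ((P ++ [ C₁ ++ C₂ ]) ∷ []) (P ++ [ C₁ ])

Infers : ∀ {V} → ℕ → List (DNF V) → DNF V → Set
Infers d premises conclusion =
  ∃₂ λ Ps P → Rule d Ps P × Pointwise _≈_ premises Ps × conclusion ≈ P

-- Acyclicity of the graph is expressed by numbering the internal nodes in a
-- topological order.
record Refutation {V : Set} (d : ℕ) (Axiom : Pred (Clause V) 0ℓ) : Set where
  field
    size : ℕ   -- number of internal nodes

  Node : Set
  Node = ∃ Axiom ⊎ Fin size

  field
    line     : Fin size → DNF V
    premises : Fin size → List Node
    root     : Node

  label : Node → DNF V
  label = [ (λ axiom → clause (proj₁ axiom)) , line ]′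

  field
    line-isDNF : ∀ k → IsDNF d (line k)
    ordered    : ∀ {j k} → inj₂ j ∈ premises k → j Fin.< k
    inference  : ∀ k → Infers d (map label (premises k)) (line k)
    root-empty : label root ≡ []
    only-sink  : ∀ k → inj₂ k ≡ root ⊎ ∃[ k′ ] inj₂ k ∈ premises k′

-- L i j, S i j and R p i are L_{i,j}, S_{i,j} and R^p_i.
data Var (d n : ℕ) : Set where
  L S : Fin n → Fin n → Var d n
  R   : Fin d → Fin n → Var d n

¬ℛ : ∀ {d n} → Fin n → Clause (Var d n)
¬ℛ {d} i = map (λ p → neg (R p i)) (allFin d)

data RLNP (d n : ℕ) : Pred (Clause (Var d n)) 0ℓ where

  irreflexive : ∀ i →
    RLNP d n (¬ℛ i ++ [ neg (L i i) ])

  transitive : ∀ i j l →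
    RLNP d n (¬ℛ i ++ ¬ℛ j ++ ¬ℛ l ++ neg (L i j) ∷ neg (L j l) ∷ pos (L i l) ∷ [])

  witness : ∀ j →
    RLNP d n (map (λ i → pos (S i j)) (allFin n))

  witness-relativized : ∀ i j p →
    RLNP d n (neg (S i j) ∷ ¬ℛ j ++ [ pos (R p i) ])

  witness-smaller : ∀ i j →
    RLNP d n (neg (S i j) ∷ ¬ℛ j ++ [ pos (L i j) ])

  last-relativized : ∀ i p → suc (toℕ i) ≡ n →
    RLNP d n [ pos (R p i) ]

-- 2^(c·n^ε) ≤ s, for positive rationals c and ε.  The real number 2^x (x ≥ 0)
-- is the supremum of 2^(k/m) over the fractions 0 ≤ k/m ≤ x.  With c = p/q and
-- ε = a/b, k/m ≤ c·n^ε iff (q·k)^b ≤ (p·m)^b·n^a, and 2^(k/m) ≤ s iff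
-- 2^k ≤ s^m.
2^[_·_^_]≤_ : ℚ → ℕ → ℚ → ℕ → Set
2^[ c · n ^ ε ]≤ s = ∀ k m → .{{NonZero m}} →
  (↧ₙ c * k) ^ (↧ₙ ε) ≤ (∣ ↥ c ∣ * m) ^ (↧ₙ ε) * n ^ ∣ ↥ ε ∣ →
  2 ^ k ≤ s ^ m

{-# OPTIONS --safe #-}

-- A random assignment of all variables is used as a restriction: an element i
-- with some Rᵖᵢ false is dead, and the relations of dead elements keep their
-- random values.  A consistent d-conjunction is true with constant probability:
-- it can contain all of R¹ᵢ, …, Rᵈᵢ only if it contains nothing else; otherwise
-- its elements may all be dead.  Hence, if a refutation is small, some
-- restriction satisfies every line having many terms that are disjoint outside
-- a few elements K, for all K and all truth values inside K.  The terms of any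
-- other line are covered by few elements; querying the cover and repeating this
-- 2 d times decides the line.  An adversary, who puts every newly queried live
-- element below the earlier ones and promises it a fresh witness, can therefore
-- walk from the empty clause along false lines, remembering few elements at a
-- time, while no axiom is ever false.

module Submission where

open import Defs
open import Data.Bool.Base using (Bool; true; false; if_then_else_; _∧_)
import Data.Bool.Properties as Bool
open import Data.Empty using (⊥; ⊥-elim)
open import Data.Fin.Base as Fin using (Fin; zero; suc; toℕ; fromℕ; combine; inject≤)
import Data.Fin.Induction as Fin
import Data.Fin.Properties as Fin
import Data.Integer.Base as ℤ
open import Data.List.Base using (List; []; _∷_; [_]; _++_; map; length; allFin; concatMap; filter; lookup)
open import Data.List.Membership.Propositional using (_∈_; _∉_; find; lose)
open import Data.List.Membership.Propositional.Properties
  using (∈-map⁺; ∈-map⁻; ∈-++⁺ˡ; ∈-++⁺ʳ; ∈-++⁻; ∈-allFin; ∈-filter⁺; ∈-filter⁻; ∈-concatMap⁺; ∈-concatMap⁻)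
open import Data.List.Properties using (length-++; length-map; length-filter; length-tabulate; map-cong-local)
open import Data.List.Relation.Binary.BagAndSetEquality using (_∼[_]_; [_]-Equality; set)
open import Data.List.Relation.Binary.Pointwise.Base using (Pointwise; []; _∷_)
open import Data.List.Relation.Unary.All as All using (All; []; _∷_)
import Data.List.Relation.Unary.All.Properties as All
open import Data.List.Relation.Unary.AllPairs as AllPairs using (AllPairs; []; _∷_)
import Data.List.Relation.Unary.AllPairs.Properties as AllPairs
open import Data.List.Relation.Unary.Any as Any using (Any; here; there; index)
import Data.List.Relation.Unary.Any.Properties as Any
open import Data.Maybe.Base using (Maybe; just; nothing; fromMaybe)
open import Data.Nat.Base
open import Data.Nat.Coprimality using (1-coprimeTo)
open import Data.Nat.ListAction using (sum; product)
open import Data.Nat.Properties hiding (_≟_)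
open import Data.Nat.Solver using (module +-*-Solver)
open import Data.Product.Base using (∃; ∃-syntax; _×_; _,_; proj₁; proj₂)
open import Data.Rational.Base using (ℚ; mkℚ; *<*; *≤*; 0ℚ; 1ℚ) renaming (_<_ to _<ℚ_; _≤_ to _≤ℚ_)
open import Data.Sum.Base using (_⊎_; inj₁; inj₂; [_,_]′)
open import Data.Unit.Base using (⊤; tt)
open import Function.Base using (_∘_; id)
open import Function.Bundles using (module Equivalence)
open import Induction.WellFounded using (Acc; acc)
open import Relation.Binary.Bundles using (module Setoid)
open import Relation.Binary.Definitions using (DecidableEquality)
open import Relation.Binary.PropositionalEquality hiding ([_])
open import Relation.Nullary using (¬_; Dec; yes; no; does; contradiction)
open import Relation.Nullary.Decidable
  using (map′; ¬?; _×-dec_; _→-dec_; decidable-stable; dec-true; dec-false; toSum)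
open import Relation.Unary using (Decidable)

-- A relation with a dead element takes its value in the restriction, with one exception: if `j` is
-- live and `i` dead, `S i j` is false, since witnesses of live elements are live. So killing `i`
-- cannot make `S i j` true when `j` is queried and live. Terms with such a literal are kept out of
-- the disjoint families; instead the search queries, besides the cover, the witnesses of the
-- elements in its node, and then either `i` is among them or the literal is false.
--
-- Little memory suffices because the value of a line depends on its search tree alone: a line found
-- false stays false when everything except the tree and the last element is forgotten.
--
-- With families of `t` terms a tree has of the order of `t ^ (2 * d)` nodes, and a union bound over
-- lines and nodes asks for `t` of the order of the logarithm of the size. Every query needs an
-- unqueried live element as witness; each block of `t` elements is certain to provide a live one.
-- So the walk succeeds if `n` exceeds a constant times `t ^ (2 * d + 1)`; one more factor absorbs
-- the constant, which gives the exponent `1 / (2 * d + 2)`.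

variable
  V : Set

-- One assignment hitting many families of disjoint conjunctions

var : Literal V → V
var = λ { (pos x) → x ; (neg x) → x }

Consistent : List (Literal V) → Set
Consistent D = ∀ {ℓ} → ℓ ∈ D → negate ℓ ∉ D

Satisfies : (V → Bool) → Literal V → Set
Satisfies α (pos x) = α x ≡ true
Satisfies α (neg x) = α x ≡ false

Hits : (V → Bool) → List (List (Literal V)) → Set
Hits α = Any (All (Satisfies α))

DisjointVars : List (Literal V) → List (Literal V) → Set
DisjointVars D D′ = ∀ {x} → x ∈ map var D → x ∉ map var D′

-- Under a uniformly random assignment the members are independent and each holds with probability
-- at least `1 / 2 ^ w`, so all of them fail with probability at most `(1 - 1 / 2 ^ w) ^ t`.
record Test (w t : ℕ) (τ : List (List (Literal V))) : Set where
  field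
    number     : length τ ≡ t
    widths     : All (λ D → length D ≤ w) τ
    consistent : All Consistent τ
    disjoint   : AllPairs DisjointVars τ

-- The method of conditional expectations: variables are set one at a time so
-- that the expected number of missed tests never increases.
module Hitting (_≟_ : DecidableEquality V) (w : ℕ) where

  open import Data.List.Membership.DecPropositional _≟_ using (_∈?_)

  Partial : Set
  Partial = V → Maybe Bool

  assign : Partial → V → Bool → Partial
  assign ρ x b y with x ≟ y
  ... | yes _ = just b
  ... | no  _ = ρ y

  assign-same : ∀ ρ x b → assign ρ x b x ≡ just b
  assign-same ρ x b with x ≟ x
  ... | yes _   = refl
  ... | no  x≢x = contradiction refl x≢x

  assign-other : ∀ ρ {x y} b → x ≢ y → assign ρ x b y ≡ ρ y
  assign-other ρ {x} {y} b x≢y with x ≟ y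
  ... | yes x≡y = contradiction x≡y x≢y
  ... | no  _   = refl

  -- Twice the conditional probability that the literal is true.
  posWeight negWeight : Maybe Bool → ℕ
  posWeight nothing      = 1
  posWeight (just true)  = 2
  posWeight (just false) = 0
  negWeight nothing      = 1
  negWeight (just true)  = 0
  negWeight (just false) = 2

  weight : Partial → Literal V → ℕ
  weight ρ (pos x) = posWeight (ρ x)
  weight ρ (neg x) = negWeight (ρ x)

  -- 2^∣D∣ times the conditional probability that D is true.
  chance : Partial → List (Literal V) → ℕ
  chance ρ D = product (map (weight ρ) D)

  -- 2^w times the conditional probability that D is false.
  risk : Partial → List (Literal V) → ℕ
  risk ρ D = 2 ^ w ∸ 2 ^ (w ∸ length D) * chance ρ D

  -- A bound on the conditional probability that all members are false, scaled by
  -- `(2 ^ w) ^ length τ`; it is a product because the members of a test are independent.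
  missing : Partial → List (List (Literal V)) → ℕ
  missing ρ τ = product (map (risk ρ) τ)

  totalMissing : Partial → List (List (List (Literal V))) → ℕ
  totalMissing ρ τs = sum (map (missing ρ) τs)

  weight≤2 : ∀ ρ ℓ → weight ρ ℓ ≤ 2
  weight≤2 ρ (pos x) with ρ x
  ... | nothing    = s≤s z≤n
  ... | just true  = ≤-refl
  ... | just false = z≤n
  weight≤2 ρ (neg x) with ρ x
  ... | nothing    = s≤s z≤n
  ... | just true  = z≤n
  ... | just false = ≤-refl

  chance≤ : ∀ ρ D → chance ρ D ≤ 2 ^ length D
  chance≤ ρ []      = ≤-refl
  chance≤ ρ (ℓ ∷ D) = *-mono-≤ (weight≤2 ρ ℓ) (chance≤ ρ D)

  risk≤ : ∀ ρ D → risk ρ D ≤ 2 ^ w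
  risk≤ ρ D = m∸n≤m (2 ^ w) (2 ^ (w ∸ length D) * chance ρ D)

  weight-other : ∀ ρ x b ℓ → x ≢ var ℓ → weight (assign ρ x b) ℓ ≡ weight ρ ℓ
  weight-other ρ x b (pos y) x≢y = cong posWeight (assign-other ρ b x≢y)
  weight-other ρ x b (neg y) x≢y = cong negWeight (assign-other ρ b x≢y)

  chance-other : ∀ ρ x b D → x ∉ map var D → chance (assign ρ x b) D ≡ chance ρ D
  chance-other ρ x b []      x∉D = refl
  chance-other ρ x b (ℓ ∷ D) x∉D =
    cong₂ _*_ (weight-other ρ x b ℓ (x∉D ∘ here)) (chance-other ρ x b D (x∉D ∘ there))

  risk-other : ∀ ρ x b D → x ∉ map var D → risk (assign ρ x b) D ≡ risk ρ D
  risk-other ρ x b D x∉D = cong (λ c → 2 ^ w ∸ 2 ^ (w ∸ length D) * c) (chance-other ρ x b D x∉D)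

  missing-other : ∀ ρ x b τ → All (λ D → x ∉ map var D) τ →
                  missing (assign ρ x b) τ ≡ missing ρ τ
  missing-other ρ x b []      []          = refl
  missing-other ρ x b (D ∷ τ) (x∉D ∷ x∉τ) =
    cong₂ _*_ (risk-other ρ x b D x∉D) (missing-other ρ x b τ x∉τ)

  lit : Bool → V → Literal V
  lit true  = pos
  lit false = neg

  weight-lit : ∀ ρ x b → ρ x ≡ nothing → weight ρ (lit b x) ≡ 1
  weight-lit ρ x true  ρx rewrite ρx = refl
  weight-lit ρ x false ρx rewrite ρx = refl

  weight-lit-assign : ∀ ρ x b → weight (assign ρ x b) (lit b x) ≡ 2
  weight-lit-assign ρ x true  rewrite assign-same ρ x true  = refl
  weight-lit-assign ρ x false rewrite assign-same ρ x false = refl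

  weight-mono : ∀ ρ x b ℓ → ρ x ≡ nothing → ℓ ≢ negate (lit b x) →
                weight ρ ℓ ≤ weight (assign ρ x b) ℓ
  weight-mono ρ x b ℓ ρx ℓ≢ with x ≟ var ℓ
  ... | no x≢ = ≤-reflexive (sym (weight-other ρ x b ℓ x≢))
  weight-mono ρ x true (pos .x) ρx ℓ≢ | yes refl
    rewrite ρx | assign-same ρ x true = s≤s z≤n
  weight-mono ρ x false (pos .x) ρx ℓ≢ | yes refl = contradiction refl ℓ≢
  weight-mono ρ x true (neg .x) ρx ℓ≢ | yes refl = contradiction refl ℓ≢
  weight-mono ρ x false (neg .x) ρx ℓ≢ | yes refl
    rewrite ρx | assign-same ρ x false = s≤s z≤n

  chance-mono : ∀ ρ x b D → ρ x ≡ nothing → negate (lit b x) ∉ D →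
                chance ρ D ≤ chance (assign ρ x b) D
  chance-mono ρ x b []      ρx ∉D = ≤-refl
  chance-mono ρ x b (ℓ ∷ D) ρx ∉D =
    *-mono-≤ (weight-mono ρ x b ℓ ρx (∉D ∘ here ∘ sym)) (chance-mono ρ x b D ρx (∉D ∘ there))

  -- Only an inequality, because the literal may be repeated in the list `D` and every occurrence
  -- doubles its weight.
  chance-double : ∀ ρ x b D → ρ x ≡ nothing → lit b x ∈ D → negate (lit b x) ∉ D →
                  2 * chance ρ D ≤ chance (assign ρ x b) D
  chance-double ρ x b (ℓ ∷ D) ρx (here refl) ∉D
    rewrite weight-lit ρ x b ρx | weight-lit-assign ρ x b | *-identityˡ (chance ρ D)
    = *-monoʳ-≤ 2 (chance-mono ρ x b D ρx (∉D ∘ there))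
  chance-double ρ x b (ℓ ∷ D) ρx (there ∈D) ∉D = begin
    2 * (weight ρ ℓ * chance ρ D)                      ≡⟨ sym (*-assoc 2 (weight ρ ℓ) _) ⟩
    2 * weight ρ ℓ * chance ρ D                        ≡⟨ cong (_* chance ρ D) (*-comm 2 (weight ρ ℓ)) ⟩
    weight ρ ℓ * 2 * chance ρ D                        ≡⟨ *-assoc (weight ρ ℓ) 2 _ ⟩
    weight ρ ℓ * (2 * chance ρ D)                      ≤⟨ *-mono-≤ (weight-mono ρ x b ℓ ρx (∉D ∘ here ∘ sym))
                                                            (chance-double ρ x b D ρx ∈D (∉D ∘ there)) ⟩
    weight (assign ρ x b) ℓ * chance (assign ρ x b) D  ∎
    where open ≤-Reasoning

  ∸-average : ∀ m a b → 2 * a ≤ b → b ≤ m → (m ∸ b) + m ≤ 2 * (m ∸ a)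
  ∸-average m a b 2a≤b b≤m = begin
    (m ∸ b) + m          ≤⟨ +-monoˡ-≤ m (∸-monoʳ-≤ m 2a≤b) ⟩
    (m ∸ 2 * a) + m      ≡⟨ +-comm (m ∸ 2 * a) m ⟩
    m + (m ∸ 2 * a)      ≡⟨ sym (+-∸-assoc m (≤-trans 2a≤b b≤m)) ⟩
    m + m ∸ 2 * a        ≡⟨ cong (_∸ 2 * a) (cong (m +_) (sym (+-identityʳ m))) ⟩
    2 * m ∸ 2 * a        ≡⟨ sym (*-distribˡ-∸ 2 m a) ⟩
    2 * (m ∸ a)          ∎
    where open ≤-Reasoning

  -- The summand `2 ^ w` stands for the opposite value of `x`, under which `D` is false and its risk
  -- is maximal.
  risk-literal : ∀ ρ x b D → length D ≤ w → ρ x ≡ nothing → lit b x ∈ D → negate (lit b x) ∉ D →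
                 risk (assign ρ x b) D + 2 ^ w ≤ 2 * risk ρ D
  risk-literal ρ x b D D≤w ρx ∈D ∉D =
    ∸-average (2 ^ w) (k * chance ρ D) (k * chance (assign ρ x b) D) doubled bounded
    where
    open ≤-Reasoning
    k = 2 ^ (w ∸ length D)
    doubled : 2 * (k * chance ρ D) ≤ k * chance (assign ρ x b) D
    doubled = begin
      2 * (k * chance ρ D)        ≡⟨ sym (*-assoc 2 k _) ⟩
      2 * k * chance ρ D          ≡⟨ cong (_* chance ρ D) (*-comm 2 k) ⟩
      k * 2 * chance ρ D          ≡⟨ *-assoc k 2 _ ⟩
      k * (2 * chance ρ D)        ≤⟨ *-monoʳ-≤ k (chance-double ρ x b D ρx ∈D ∉D) ⟩
      k * chance (assign ρ x b) D ∎
    bounded : k * chance (assign ρ x b) D ≤ 2 ^ w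
    bounded = begin
      k * chance (assign ρ x b) D   ≤⟨ *-monoʳ-≤ k (chance≤ _ D) ⟩
      k * 2 ^ length D              ≡⟨ sym (^-distribˡ-+-* 2 (w ∸ length D) (length D)) ⟩
      2 ^ (w ∸ length D + length D) ≡⟨ cong (2 ^_) (m∸n+n≡m D≤w) ⟩
      2 ^ w                         ∎

  risk-average : ∀ ρ x D → length D ≤ w → Consistent D → ρ x ≡ nothing → x ∈ map var D →
                 risk (assign ρ x true) D + risk (assign ρ x false) D ≤ 2 * risk ρ D
  risk-average ρ x D D≤w con ρx x∈D with ∈-map⁻ var x∈D
  ... | pos .x , ∈D , refl = ≤-trans
    (+-monoʳ-≤ (risk (assign ρ x true) D) (risk≤ _ D))
    (risk-literal ρ x true D D≤w ρx ∈D (con ∈D))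
  ... | neg .x , ∈D , refl = ≤-trans
    (≤-trans (+-monoˡ-≤ (risk (assign ρ x false) D) (risk≤ _ D))
             (≤-reflexive (+-comm (2 ^ w) _)))
    (risk-literal ρ x false D D≤w ρx ∈D (con ∈D))

  -- By disjointness `x` occurs in at most one member, so at most one factor of the product changes,
  -- and the average is linear in that factor.
  missing-average : ∀ ρ x τ → All (λ D → length D ≤ w) τ → All Consistent τ →
    AllPairs DisjointVars τ → ρ x ≡ nothing →
    missing (assign ρ x true) τ + missing (assign ρ x false) τ ≤ 2 * missing ρ τ
  missing-average ρ x [] [] [] [] ρx = ≤-refl
  missing-average ρ x (D ∷ τ) (D≤w ∷ τ≤w) (con ∷ cons) (dis ∷ diss) ρx with x ∈? map var D
  ... | yes x∈D
    rewrite missing-other ρ x true τ (All.map (λ d → d x∈D) dis)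
          | missing-other ρ x false τ (All.map (λ d → d x∈D) dis) = begin
    r₁ * p + r₂ * p          ≡⟨ sym (*-distribʳ-+ p r₁ r₂) ⟩
    (r₁ + r₂) * p            ≤⟨ *-monoˡ-≤ p (risk-average ρ x D D≤w con ρx x∈D) ⟩
    2 * risk ρ D * p         ≡⟨ *-assoc 2 (risk ρ D) p ⟩
    2 * (risk ρ D * p)       ∎
    where
    open ≤-Reasoning
    r₁ = risk (assign ρ x true) D
    r₂ = risk (assign ρ x false) D
    p  = missing ρ τ
  ... | no x∉D
    rewrite risk-other ρ x true D x∉D | risk-other ρ x false D x∉D = begin
    r * p₁ + r * p₂          ≡⟨ sym (*-distribˡ-+ r p₁ p₂) ⟩
    r * (p₁ + p₂)            ≤⟨ *-monoʳ-≤ r (missing-average ρ x τ τ≤w cons diss ρx) ⟩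
    r * (2 * missing ρ τ)    ≡⟨ sym (*-assoc r 2 _) ⟩
    r * 2 * missing ρ τ      ≡⟨ cong (_* missing ρ τ) (*-comm r 2) ⟩
    2 * r * missing ρ τ      ≡⟨ *-assoc 2 r _ ⟩
    2 * (r * missing ρ τ)    ∎
    where
    open ≤-Reasoning
    r  = risk ρ D
    p₁ = missing (assign ρ x true) τ
    p₂ = missing (assign ρ x false) τ

  totalMissing-average : ∀ {t} ρ x τs → All (Test w t) τs → ρ x ≡ nothing →
    totalMissing (assign ρ x true) τs + totalMissing (assign ρ x false) τs ≤ 2 * totalMissing ρ τs
  totalMissing-average ρ x []       []         ρx = ≤-refl
  totalMissing-average ρ x (τ ∷ τs) (tst ∷ tsts) ρx = begin
    (p₁ + s₁) + (p₂ + s₂)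
      ≡⟨ solve 4 (λ a b c d → (a :+ b) :+ (c :+ d) := (a :+ c) :+ (b :+ d)) refl p₁ s₁ p₂ s₂ ⟩
    (p₁ + p₂) + (s₁ + s₂)
      ≤⟨ +-mono-≤ (missing-average ρ x τ widths consistent disjoint ρx)
                  (totalMissing-average ρ x τs tsts ρx) ⟩
    2 * missing ρ τ + 2 * totalMissing ρ τs
      ≡⟨ sym (*-distribˡ-+ 2 (missing ρ τ) _) ⟩
    2 * (missing ρ τ + totalMissing ρ τs) ∎
    where
    open ≤-Reasoning
    open +-*-Solver
    open Test tst
    p₁ = missing (assign ρ x true) τ
    p₂ = missing (assign ρ x false) τ
    s₁ = totalMissing (assign ρ x true) τs
    s₂ = totalMissing (assign ρ x false) τs

  ≤-average : ∀ a b c → a + b ≤ 2 * c → a ≤ c ⊎ b ≤ c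
  ≤-average a b c a+b≤2c with a ≤? c
  ... | yes a≤c = inj₁ a≤c
  ... | no  a≰c with b ≤? c
  ...   | yes b≤c = inj₂ b≤c
  ...   | no  b≰c = contradiction
    (≤-trans (+-mono-< (≰⇒> a≰c) (≰⇒> b≰c)) (≤-trans a+b≤2c (≤-reflexive (cong (c +_) (+-identityʳ c)))))
    (<-irrefl refl)

  Settled : Partial → V → Set
  Settled ρ x = ∃[ b ] ρ x ≡ just b

  assign-settled : ∀ ρ x b y → Settled ρ y → Settled (assign ρ x b) y
  assign-settled ρ x b y (c , ρy) with x ≟ y
  ... | yes _ = b , refl
  ... | no  _ = c , ρy

  Settling : List (List (List (Literal V))) → List V → Partial → Set
  Settling τs xs ρ = ∃[ ρ′ ] totalMissing ρ′ τs ≤ totalMissing ρ τs ×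
    All (Settled ρ′) xs × (∀ y → Settled ρ y → Settled ρ′ y)

  settle : ∀ {t} τs → All (Test w t) τs → ∀ xs ρ → Settling τs xs ρ
  settle τs tsts []       ρ = ρ , ≤-refl , [] , λ _ s → s
  settle τs tsts (x ∷ xs) ρ with ρ x in ρx
  ... | just b with ρ′ , le , fixed , ext ← settle τs tsts xs ρ = ρ′ , le , ext x (b , ρx) ∷ fixed , ext
  ... | nothing = [ with-value true , with-value false ]′ (≤-average _ _ _ (totalMissing-average ρ x τs tsts ρx))
    where
    with-value : ∀ b → totalMissing (assign ρ x b) τs ≤ totalMissing ρ τs → Settling τs (x ∷ xs) ρ
    with-value b le with ρ′ , le′ , fixed , ext ← settle τs tsts xs (assign ρ x b) =
      ρ′ , ≤-trans le′ le , ext x (b , assign-same ρ x b) ∷ fixed ,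
      λ y s → ext y (assign-settled ρ x b y s)

  toTotal : Partial → V → Bool
  toTotal ρ x = fromMaybe false (ρ x)

  satisfied⊎zero : ∀ ρ D → All (Settled ρ) (map var D) →
                   All (Satisfies (toTotal ρ)) D ⊎ chance ρ D ≡ 0
  satisfied⊎zero ρ []      []        = inj₁ []
  satisfied⊎zero ρ (ℓ ∷ D) (s ∷ fixed) with satisfied⊎zero ρ D fixed
  ... | inj₂ z = inj₂ (trans (cong (weight ρ ℓ *_) z) (*-zeroʳ (weight ρ ℓ)))
  satisfied⊎zero ρ (pos x ∷ D) ((true , ρx) ∷ fixed) | inj₁ sat = inj₁ (cong (fromMaybe false) ρx ∷ sat)
  satisfied⊎zero ρ (pos x ∷ D) ((false , ρx) ∷ fixed) | inj₁ sat rewrite ρx = inj₂ refl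
  satisfied⊎zero ρ (neg x ∷ D) ((true , ρx) ∷ fixed) | inj₁ sat rewrite ρx = inj₂ refl
  satisfied⊎zero ρ (neg x ∷ D) ((false , ρx) ∷ fixed) | inj₁ sat = inj₁ (cong (fromMaybe false) ρx ∷ sat)

  testVars : List (List (Literal V)) → List V
  testVars = concatMap (map var)

  hits⊎missing : ∀ ρ τ → (∀ {x} → x ∈ testVars τ → Settled ρ x) →
                 Hits (toTotal ρ) τ ⊎ missing ρ τ ≡ (2 ^ w) ^ length τ
  hits⊎missing ρ []      fixed = inj₂ refl
  hits⊎missing ρ (D ∷ τ) fixed with hits⊎missing ρ τ (fixed ∘ ∈-++⁺ʳ (map var D))
  ... | inj₁ hit = inj₁ (there hit)
  ... | inj₂ eq with satisfied⊎zero ρ D (All.tabulate (fixed ∘ ∈-++⁺ˡ))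
  ...   | inj₁ sat = inj₁ (here sat)
  ...   | inj₂ z   = inj₂ (cong₂ _*_
    (trans (cong (λ c → 2 ^ w ∸ 2 ^ (w ∸ length D) * c) z) (cong (2 ^ w ∸_) (*-zeroʳ (2 ^ (w ∸ length D))))) eq)

  missing≤total : ∀ ρ {τ τs} → τ ∈ τs → missing ρ τ ≤ totalMissing ρ τs
  missing≤total ρ (here refl) = m≤m+n _ _
  missing≤total ρ (there τ∈)  = ≤-trans (missing≤total ρ τ∈) (m≤n+m _ _)

  unset : Partial
  unset _ = nothing

  chance-unset : ∀ D → chance unset D ≡ 1
  chance-unset []          = refl
  chance-unset (pos x ∷ D) = trans (+-identityʳ _) (chance-unset D)
  chance-unset (neg x ∷ D) = trans (+-identityʳ _) (chance-unset D)

  risk-unset : ∀ D → risk unset D ≤ 2 ^ w ∸ 1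
  risk-unset D = ∸-monoʳ-≤ {1} (2 ^ w) (begin
    1                                    ≤⟨ m^n>0 2 (w ∸ length D) ⟩
    2 ^ (w ∸ length D)                   ≡⟨ sym (*-identityʳ _) ⟩
    2 ^ (w ∸ length D) * 1               ≡⟨ cong (2 ^ (w ∸ length D) *_) (sym (chance-unset D)) ⟩
    2 ^ (w ∸ length D) * chance unset D  ∎)
    where open ≤-Reasoning

  missing-unset : ∀ τ → missing unset τ ≤ (2 ^ w ∸ 1) ^ length τ
  missing-unset []      = ≤-refl
  missing-unset (D ∷ τ) = *-mono-≤ (risk-unset D) (missing-unset τ)

  totalMissing-unset : ∀ {t} τs → All (Test w t) τs → totalMissing unset τs ≤ length τs * (2 ^ w ∸ 1) ^ t
  totalMissing-unset []       []           = z≤n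
  totalMissing-unset (τ ∷ τs) (tst ∷ tsts) =
    +-mono-≤ (subst (λ t → missing unset τ ≤ (2 ^ w ∸ 1) ^ t) (Test.number tst) (missing-unset τ))
             (totalMissing-unset τs tsts)

  -- Once all variables are set, a missed test alone contributes `(2 ^ w) ^ t` to `totalMissing`,
  -- which starts below this value and has not increased.
  hitting : ∀ {t} τs → All (Test w t) τs → length τs * (2 ^ w ∸ 1) ^ t < (2 ^ w) ^ t →
            ∃[ α ] (∀ {τ} → τ ∈ τs → Hits α τ)
  hitting {t} τs tsts few
    with ρ , le , fixed , _ ← settle τs tsts (concatMap testVars τs) unset = toTotal ρ , hit
    where
    hit : ∀ {τ} → τ ∈ τs → Hits (toTotal ρ) τ
    hit {τ} τ∈ with hits⊎missing ρ τ (λ x∈ → All.lookup fixed (∈-concatMap⁺ testVars (Any.map (λ { refl → x∈ }) τ∈)))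
    ... | inj₁ h  = h
    ... | inj₂ eq = contradiction
      (subst (λ k → (2 ^ w) ^ k ≤ length τs * (2 ^ w ∸ 1) ^ t) (Test.number (All.lookup tsts τ∈))
        (≤-trans (≤-reflexive (sym eq)) (≤-trans (missing≤total ρ τ∈) (≤-trans le (totalMissing-unset τs tsts)))))
      (<⇒≱ few)

-- States of the adversary

upper-bound : ∀ {A : Set} (f : A → ℕ) xs → ∃[ M ] (∀ {x} → x ∈ xs → f x < M)
upper-bound f []       = 0 , λ ()
upper-bound f (x ∷ xs) with M , lt ← upper-bound f xs =
  suc (f x) ⊔ M ,
  λ { (here refl) → m≤m⊔n _ M ; (there x∈) → ≤-trans (lt x∈) (m≤n⊔m _ M) }

negate-negate : (ℓ : Literal V) → negate (negate ℓ) ≡ ℓ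
negate-negate (pos x) = refl
negate-negate (neg x) = refl

∼-sym : {C D : Conjunction V} → C ∼[ set ] D → D ∼[ set ] C
∼-sym {V} C∼D = Setoid.sym ([ set ]-Equality (Literal V)) C∼D

∈⇒∼∈ : {C : Conjunction V} {P : DNF V} → C ∈ P → Any (C ∼[ set ]_) P
∈⇒∼∈ {V} {C} = Any.map λ { refl {ℓ} → Setoid.refl ([ set ]-Equality (Literal V)) {C} {ℓ} }

-- β is the restriction: it decides which elements are relativized and fixes the
-- relations of all other elements.
module Semantics {d n : ℕ} (β : Var d n → Bool) where

  open import Data.List.Membership.DecPropositional (Fin._≟_ {n}) using (_∈?_)

  Live : Fin n → Set
  Live i = ∀ p → β (R p i) ≡ true

  abstract
    live? : ∀ i → Dec (Live i)
    live? i = Fin.all? λ p → β (R p i) Bool.≟ true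

  -- Positions increase downwards: the least elements have the largest positions.
  record State : Set where
    constructor state
    field
      queried  : List (Fin n)
      position : Fin n → ℕ
      wit      : Fin n → Fin n

  open State public

  -- An unqueried witness is a mere promise; its place in the order matters only once it has been
  -- queried itself.
  Valid : State → Set
  Valid Σ = ∀ {j} → j ∈ queried Σ →
    Live (wit Σ j) × (wit Σ j ∈ queried Σ → position Σ j < position Σ (wit Σ j))

  -- Meaningful only for variables determined by the state.
  truth : State → Var d n → Bool
  truth Σ (R p i) = β (R p i)
  truth Σ (L i j) = if does (live? i) ∧ does (live? j)
                    then does (position Σ j <? position Σ i) else β (L i j)
  truth Σ (S i j) = if does (live? j)
                    then does (live? i) ∧ does (i Fin.≟ wit Σ j) else β (S i j)

  -- Liveness is fixed by `β`, so only relations among live elements need queries. For `S i j` it is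
  -- enough to query `j`: the witness of `j` belongs to the state even while it is itself unqueried.
  Determined : State → Var d n → Set
  Determined Σ (R p i) = ⊤
  Determined Σ (L i j) = Live i → Live j → i ∈ queried Σ × j ∈ queried Σ
  Determined Σ (S i j) = Live i → Live j → j ∈ queried Σ

  Holds Fails : State → Literal (Var d n) → Set
  Holds Σ ℓ = Determined Σ (var ℓ) × Satisfies (truth Σ) ℓ
  Fails Σ ℓ = Determined Σ (var ℓ) × Satisfies (truth Σ) (negate ℓ)

  Contradictory : Conjunction (Var d n) → Set
  Contradictory C = ∃[ ℓ ] ℓ ∈ C × negate ℓ ∈ C

  -- A contradictory term counts as false even if none of its variables is determined, so that no
  -- query is spent on it.
  TrueTerm FalseTerm : State → Conjunction (Var d n) → Set
  TrueTerm  Σ C = All (Holds Σ) C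
  FalseTerm Σ C = Any (Fails Σ) C ⊎ Contradictory C

  TrueDNF FalseDNF : State → DNF (Var d n) → Set
  TrueDNF  Σ P = Any (TrueTerm Σ) P
  FalseDNF Σ P = All (FalseTerm Σ) P

  satisfies-exclusive : ∀ (α : Var d n → Bool) ℓ → Satisfies α ℓ → ¬ Satisfies α (negate ℓ)
  satisfies-exclusive α (pos x) t f with () ← trans (sym t) f
  satisfies-exclusive α (neg x) f t with () ← trans (sym t) f

  term-exclusive : ∀ {Σ C} → TrueTerm Σ C → ¬ FalseTerm Σ C
  term-exclusive {Σ} (t ∷ ts) (inj₁ (here f)) = satisfies-exclusive (truth Σ) _ (proj₂ t) (proj₂ f)
  term-exclusive {Σ} (t ∷ ts) (inj₁ (there f)) = term-exclusive {Σ} ts (inj₁ f)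
  term-exclusive {Σ} t (inj₂ (ℓ , ℓ∈ , ¬ℓ∈)) =
    satisfies-exclusive (truth Σ) ℓ (proj₂ (All.lookup t ℓ∈)) (proj₂ (All.lookup t ¬ℓ∈))

  TrueTerm-resp : ∀ {Σ C D} → C ∼[ set ] D → TrueTerm Σ C → TrueTerm Σ D
  TrueTerm-resp C∼D t = All.tabulate λ ℓ∈D → All.lookup t (Equivalence.from C∼D ℓ∈D)

  FalseTerm-resp : ∀ {Σ C D} → C ∼[ set ] D → FalseTerm Σ C → FalseTerm Σ D
  FalseTerm-resp C∼D (inj₁ f) with ℓ , ℓ∈C , fℓ ← find f = inj₁ (lose (Equivalence.to C∼D ℓ∈C) fℓ)
  FalseTerm-resp C∼D (inj₂ (ℓ , ℓ∈ , ¬ℓ∈)) = inj₂ (ℓ , Equivalence.to C∼D ℓ∈ , Equivalence.to C∼D ¬ℓ∈)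

  TrueDNF-resp : ∀ {Σ P Q} → P ≈ Q → TrueDNF Σ P → TrueDNF Σ Q
  TrueDNF-resp {Σ} {Q = Q} (P⊆Q , _) t with C , C∈P , tC ← find t =
    Any.map (λ {D} (C∼D : C ∼[ set ] D) → TrueTerm-resp {Σ} {C} {D} C∼D tC) C∈Q
    where
    C∈Q : Any (C ∼[ set ]_) Q
    C∈Q = P⊆Q (∈⇒∼∈ C∈P)

  FalseDNF-resp : ∀ {Σ P Q} → P ≈ Q → FalseDNF Σ P → FalseDNF Σ Q
  FalseDNF-resp {Σ} {P} (_ , Q⊆P) f = All.tabulate false-in-P
    where
    false-in-P : ∀ {D} → D ∈ _ → FalseTerm Σ D
    false-in-P {D} D∈Q with C , C∈P , D∼C ← find {P = D ∼[ set ]_} (Q⊆P (∈⇒∼∈ D∈Q)) =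
      FalseTerm-resp {Σ} {C} {D} (∼-sym {C = D} {C} D∼C) (All.lookup f C∈P)

  dnf-exclusive : ∀ {Σ P} → TrueDNF Σ P → ¬ FalseDNF Σ P
  dnf-exclusive {Σ} (here t)  (f ∷ _)  = term-exclusive {Σ} t f
  dnf-exclusive {Σ} (there t) (_ ∷ fs) = dnf-exclusive {Σ} t fs

  last-term : ∀ {Σ} P {C} → TrueDNF Σ (P ++ [ C ]) → FalseDNF Σ P → TrueTerm Σ C
  last-term {Σ} P t f with Any.++⁻ P t
  ... | inj₁ tP       = contradiction f (dnf-exclusive {Σ} tP)
  ... | inj₂ (here t) = t

  -- Truth and falsity are not complementary, since a line may be undetermined; soundness therefore
  -- takes the form of a clash between true premises and a false conclusion.
  rule-sound : ∀ {Σ Ps P} → Rule d Ps P → All (TrueDNF Σ) Ps → ¬ FalseDNF Σ P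
  rule-sound {Σ} (∧-introduction P Q C₁ C₂ _) (t₁ ∷ t₂ ∷ []) f
    with fP , fQC ← All.++⁻ P f with fQ , fC ∷ [] ← All.++⁻ Q fQC =
    term-exclusive {Σ} (All.++⁺ (last-term {Σ} P t₁ fP) (last-term {Σ} Q t₂ fQ)) fC
  rule-sound {Σ} (cut P Q ℓs) (t₁ ∷ t₂ ∷ []) f with fP , fQ ← All.++⁻ P f with Any.++⁻ P t₁
  ... | inj₁ tP = dnf-exclusive {Σ} tP fP
  ... | inj₂ tℓs with ℓ , ℓ∈ , (_ , tℓ) ∷ [] ← find (Any.map⁻ tℓs) =
    satisfies-exclusive (truth Σ) ℓ tℓ (proj₂ (All.lookup (last-term {Σ} Q t₂ fQ) (∈-map⁺ negate ℓ∈)))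
  rule-sound {Σ} (weakening₁ P C _) (t ∷ []) f = dnf-exclusive {Σ} t (All.++⁻ˡ P f)
  rule-sound {Σ} (weakening₂ P C₁ C₂) (t ∷ []) f with fP , fC ∷ [] ← All.++⁻ P f =
    term-exclusive {Σ} (All.++⁻ˡ C₁ (last-term {Σ} P t fP)) fC

  TrueDNFs-resp : ∀ {Σ Ps Qs} → Pointwise _≈_ Ps Qs → All (TrueDNF Σ) Ps → All (TrueDNF Σ) Qs
  TrueDNFs-resp     []       []       = []
  TrueDNFs-resp {Σ} (e ∷ es) (t ∷ ts) = TrueDNF-resp {Σ} e t ∷ TrueDNFs-resp {Σ} es ts

  inference-sound : ∀ {Σ Ps P} → Infers d Ps P → All (TrueDNF Σ) Ps → ¬ FalseDNF Σ P
  inference-sound {Σ} (_ , _ , rule , Ps≈ , P≈) ts f =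
    rule-sound {Σ} rule (TrueDNFs-resp {Σ} Ps≈ ts) (FalseDNF-resp {Σ} P≈ f)

  infix 4 _⊑_
  record _⊑_ (Σ Σ′ : State) : Set where
    field
      queried-⊆     : ∀ {i} → i ∈ queried Σ → i ∈ queried Σ′
      position-same : ∀ {i} → i ∈ queried Σ → position Σ′ i ≡ position Σ i
      wit-same      : ∀ {i} → i ∈ queried Σ → wit Σ′ i ≡ wit Σ i

  open _⊑_ public

  ⊑-refl : ∀ {Σ} → Σ ⊑ Σ
  ⊑-refl = record { queried-⊆ = λ i∈ → i∈ ; position-same = λ _ → refl ; wit-same = λ _ → refl }

  ⊑-trans : ∀ {Σ Σ′ Σ″} → Σ ⊑ Σ′ → Σ′ ⊑ Σ″ → Σ ⊑ Σ″
  ⊑-trans e f = record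
    { queried-⊆     = queried-⊆ f ∘ queried-⊆ e
    ; position-same = λ i∈ → trans (position-same f (queried-⊆ e i∈)) (position-same e i∈)
    ; wit-same      = λ i∈ → trans (wit-same f (queried-⊆ e i∈)) (wit-same e i∈)
    }

  determined-mono : ∀ {Σ Σ′} → Σ ⊑ Σ′ → ∀ v → Determined Σ v → Determined Σ′ v
  determined-mono e (R p i) _   = tt
  determined-mono e (L i j) det = λ li lj → let i∈ , j∈ = det li lj in queried-⊆ e i∈ , queried-⊆ e j∈
  determined-mono e (S i j) det = λ li lj → queried-⊆ e (det li lj)

  truth-mono : ∀ {Σ Σ′} → Σ ⊑ Σ′ → ∀ v → Determined Σ v → truth Σ′ v ≡ truth Σ v
  truth-mono e (R p i) det = refl
  truth-mono e (L i j) det with live? i | live? j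
  ... | yes li | yes lj with i∈ , j∈ ← det li lj rewrite position-same e i∈ | position-same e j∈ = refl
  ... | yes _  | no  _  = refl
  ... | no  _  | _      = refl
  truth-mono e (S i j) det with live? i | live? j
  ... | yes li | yes lj rewrite wit-same e (det li lj) = refl
  ... | no  _  | yes _  = refl
  ... | _      | no  _  = refl

  satisfies-cong : ∀ {α α′ : Var d n → Bool} ℓ → α′ (var ℓ) ≡ α (var ℓ) → Satisfies α ℓ → Satisfies α′ ℓ
  satisfies-cong (pos x) eq s = trans eq s
  satisfies-cong (neg x) eq s = trans eq s

  var-negate : ∀ (ℓ : Literal (Var d n)) → var (negate ℓ) ≡ var ℓ
  var-negate (pos x) = refl
  var-negate (neg x) = refl

  holds-mono : ∀ {Σ Σ′} → Σ ⊑ Σ′ → ∀ {ℓ} → Holds Σ ℓ → Holds Σ′ ℓ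
  holds-mono e {ℓ} (det , s) =
    determined-mono e (var ℓ) det , satisfies-cong ℓ (truth-mono e (var ℓ) det) s

  fails-mono : ∀ {Σ Σ′} → Σ ⊑ Σ′ → ∀ {ℓ} → Fails Σ ℓ → Fails Σ′ ℓ
  fails-mono {Σ} {Σ′} e {ℓ} (det , s) = determined-mono e (var ℓ) det ,
    satisfies-cong (negate ℓ) (subst (λ v → truth Σ′ v ≡ truth Σ v) (sym (var-negate ℓ)) (truth-mono e (var ℓ) det)) s

  TrueDNF-mono : ∀ {Σ Σ′} → Σ ⊑ Σ′ → ∀ {P} → TrueDNF Σ P → TrueDNF Σ′ P
  TrueDNF-mono e = Any.map (All.map (λ {ℓ} → holds-mono e {ℓ}))

  FalseDNF-mono : ∀ {Σ Σ′} → Σ ⊑ Σ′ → ∀ {P} → FalseDNF Σ P → FalseDNF Σ′ P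
  FalseDNF-mono e = All.map λ { (inj₁ f) → inj₁ (Any.map (λ {ℓ} → fails-mono e {ℓ}) f) ; (inj₂ c) → inj₂ c }

  -- A new element goes below all queried ones; its fresh witness stays unqueried.
  query : ∀ Σ → Valid Σ → ∀ x w → Live w → w ∉ x ∷ queried Σ →
          ∃[ Σ′ ] Valid Σ′ × Σ ⊑ Σ′ × x ∈ queried Σ′ × length (queried Σ′) ≤ suc (length (queried Σ))
  query Σ valid x w lw w∉ with x ∈? queried Σ
  ... | yes x∈ = Σ , valid , ⊑-refl , x∈ , n≤1+n _
  ... | no x∉ with M , below ← upper-bound (position Σ) (queried Σ) =
    Σ′ , valid′ , extends , here refl , ≤-refl
    where
    set-at : ∀ {A : Set} → A → (Fin n → A) → Fin n → A
    set-at a f y = if does (y Fin.≟ x) then a else f y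
    Σ′ : State
    Σ′ = state (x ∷ queried Σ) (set-at M (position Σ)) (set-at w (wit Σ))
    set-at-other : ∀ {A : Set} {a : A} f {y} → y ∈ queried Σ → set-at a f y ≡ f y
    set-at-other f {y} y∈ with y Fin.≟ x
    ... | yes refl = contradiction y∈ x∉
    ... | no  _    = refl
    set-at-same : ∀ {A : Set} {a : A} f → set-at a f x ≡ a
    set-at-same f rewrite dec-true (x Fin.≟ x) refl = refl
    extends : Σ ⊑ Σ′
    extends = record
      { queried-⊆ = there ; position-same = set-at-other (position Σ) ; wit-same = set-at-other (wit Σ) }
    valid′ : Valid Σ′
    valid′ (here refl) rewrite set-at-same {a = w} (wit Σ) = lw , λ w∈ → contradiction w∈ w∉
    valid′ {j} (there j∈) rewrite set-at-other {a = w} (wit Σ) j∈ | set-at-other {a = M} (position Σ) j∈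
      with lwj , lower ← valid j∈ = lwj , λ
        { (here wj≡x) → subst (λ y → position Σ j < set-at M (position Σ) y) (sym wj≡x)
            (subst (position Σ j <_) (sym (set-at-same (position Σ))) (below j∈))
        ; (there wj∈) → subst (position Σ j <_) (sym (set-at-other (position Σ) wj∈)) (lower wj∈) }

  ¬live⇒¬ℛ : ∀ Σ {i} → ¬ Live i → ∃[ ℓ ] ℓ ∈ ¬ℛ i × Holds Σ ℓ
  ¬live⇒¬ℛ Σ {i} dead with p , Rp ← Fin.¬∀⟶∃¬ d (λ p → β (R p i) ≡ true) (λ p → β (R p i) Bool.≟ true) dead =
    neg (R p i) , ∈-map⁺ (λ p → neg (R p i)) (∈-allFin p) , tt , Bool.¬-not Rp

  true-clause : ∀ {Σ} {D : Clause (Var d n)} {ℓ} → ℓ ∈ D → Holds Σ ℓ → TrueDNF Σ (clause D)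
  true-clause {Σ} ℓ∈D h = Any.map⁺ (Any.map (λ { refl → h ∷ [] }) ℓ∈D)

  truth-L : ∀ Σ {i j} → Live i → Live j → truth Σ (L i j) ≡ does (position Σ j <? position Σ i)
  truth-L Σ {i} {j} li lj rewrite dec-true (live? i) li | dec-true (live? j) lj = refl

  truth-S : ∀ Σ {i j} → Live i → Live j → truth Σ (S i j) ≡ does (i Fin.≟ wit Σ j)
  truth-S Σ {i} {j} li lj rewrite dec-true (live? i) li | dec-true (live? j) lj = refl

  truth-L-dead : ∀ Σ {i j} → ¬ Live i ⊎ ¬ Live j → truth Σ (L i j) ≡ β (L i j)
  truth-L-dead Σ {i} {j} dead with live? i | live? j
  truth-L-dead Σ (inj₁ ¬li) | yes li | yes _ = contradiction li ¬li
  truth-L-dead Σ (inj₂ ¬lj) | yes _ | yes lj = contradiction lj ¬lj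
  ... | yes _ | no _ = refl
  ... | no _  | _    = refl

  truth-S-dead : ∀ Σ {i j} → ¬ Live j → truth Σ (S i j) ≡ β (S i j)
  truth-S-dead Σ {i} {j} ¬lj rewrite dec-false (live? j) ¬lj = refl

  -- Here the random value is overridden: a true `S i j` would violate `witness-relativized`.
  truth-S-missed : ∀ Σ {i j} → Live j → ¬ Live i → truth Σ (S i j) ≡ false
  truth-S-missed Σ {i} {j} lj ¬li rewrite dec-true (live? j) lj | dec-false (live? i) ¬li = refl

  -- The queries after which the axiom has a true literal. For `witness j` the element `j` suffices,
  -- because its promised witness need not be queried.
  support : ∀ {D} → RLNP d n D → List (Fin n)
  support (irreflexive i)           = i ∷ []
  support (transitive i j l)        = i ∷ j ∷ l ∷ []
  support (witness j)               = j ∷ []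
  support (witness-relativized i j p) = j ∷ []
  support (witness-smaller i j)     = i ∷ j ∷ []
  support (last-relativized i p _)  = []

  support≤3 : ∀ {D} (A : RLNP d n D) → length (support A) ≤ 3
  support≤3 (irreflexive i)           = s≤s z≤n
  support≤3 (transitive i j l)        = ≤-refl
  support≤3 (witness j)               = s≤s z≤n
  support≤3 (witness-relativized i j p) = s≤s z≤n
  support≤3 (witness-smaller i j)     = s≤s (s≤s z≤n)
  support≤3 (last-relativized i p _)  = z≤n

  module _ (last-live : ∀ i → suc (toℕ i) ≡ n → Live i)
           (all-witnessed : ∀ j → ∃[ i ] β (S i j) ≡ true) where

    -- A clause containing `¬ℛ i` holds when `i` is dead. Two kinds of axiom lack this escape:
    -- `witness`, which needs `all-witnessed` for dead `j`, and `last-relativized`, which needs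
    -- `last-live`.
    axiom-true : ∀ {Σ D} (A : RLNP d n D) → Valid Σ → (∀ {i} → i ∈ support A → i ∈ queried Σ) →
                 TrueDNF Σ (clause D)
    axiom-true {Σ} {D} A valid known = let _ , ℓ∈ , h = literal A known in true-clause {Σ} ℓ∈ h
      where
      relativized : ∀ {i} {D : Clause (Var d n)} → (∀ {ℓ} → ℓ ∈ ¬ℛ i → ℓ ∈ D) →
                    (Live i → ∃[ ℓ ] ℓ ∈ D × Holds Σ ℓ) → ∃[ ℓ ] ℓ ∈ D × Holds Σ ℓ
      relativized {i} incl k with live? i
      ... | yes li = k li
      ... | no ¬li = let ℓ , ℓ∈ , h = ¬live⇒¬ℛ Σ ¬li in ℓ , incl ℓ∈ , h

      not-above : ∀ {i j} → position Σ i ≤ position Σ j → does (position Σ j <? position Σ i) ≡ false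
      not-above le = dec-false (_ <? _) (≤⇒≯ le)
    
      literal : ∀ {D} (A : RLNP d n D) → (∀ {i} → i ∈ support A → i ∈ queried Σ) → ∃[ ℓ ] ℓ ∈ D × Holds Σ ℓ
      literal (irreflexive i) known = relativized {i} ∈-++⁺ˡ λ li →
        neg (L i i) , ∈-++⁺ʳ (¬ℛ i) (here refl) , (λ _ _ → known (here refl) , known (here refl)) ,
        trans (truth-L Σ li li) (not-above {i} {i} ≤-refl)
      literal (transitive i j l) known =
        relativized {i} ∈-++⁺ˡ λ li →
        relativized {j} (∈-++⁺ʳ (¬ℛ i) ∘ ∈-++⁺ˡ) λ lj →
        relativized {l} (∈-++⁺ʳ (¬ℛ i) ∘ ∈-++⁺ʳ (¬ℛ j) ∘ ∈-++⁺ˡ) λ ll →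
        ordered li lj ll
        where
        i∈ = known (here refl)
        j∈ = known (there (here refl))
        l∈ = known (there (there (here refl)))
        tail : ∀ {ℓ} → ℓ ∈ neg (L i j) ∷ neg (L j l) ∷ pos (L i l) ∷ [] → ℓ ∈ ¬ℛ i ++ ¬ℛ j ++ ¬ℛ l ++ _
        tail = ∈-++⁺ʳ (¬ℛ i) ∘ ∈-++⁺ʳ (¬ℛ j) ∘ ∈-++⁺ʳ (¬ℛ l)
        ordered : Live i → Live j → Live l → _
        ordered li lj ll with position Σ j <? position Σ i | position Σ l <? position Σ j
        ... | no ji | _ = neg (L i j) , tail (here refl) , (λ _ _ → i∈ , j∈) ,
                          trans (truth-L Σ li lj) (dec-false (_ <? _) ji)
        ... | yes _ | no lj′ = neg (L j l) , tail (there (here refl)) , (λ _ _ → j∈ , l∈) ,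
                          trans (truth-L Σ lj ll) (dec-false (_ <? _) lj′)
        ... | yes ji | yes lj′ = pos (L i l) , tail (there (there (here refl))) , (λ _ _ → i∈ , l∈) ,
                          trans (truth-L Σ li ll) (dec-true (_ <? _) (<-trans lj′ ji))
      literal (witness j) known with live? j
      ... | yes lj = pos (S (wit Σ j) j) , ∈-map⁺ _ (∈-allFin (wit Σ j)) , (λ _ _ → known (here refl)) ,
                     trans (truth-S Σ (proj₁ (valid (known (here refl)))) lj) (dec-true (wit Σ j Fin.≟ wit Σ j) refl)
      ... | no ¬lj with i , Sij ← all-witnessed j =
                     pos (S i j) , ∈-map⁺ _ (∈-allFin i) , (λ _ lj → contradiction lj ¬lj) ,
                     trans (truth-S-dead Σ ¬lj) Sij
      literal (witness-relativized i j p) known = relativized {j} (there ∘ ∈-++⁺ˡ) λ lj → case lj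
        where
        case : Live j → _
        case lj with live? i
        ... | yes li = pos (R p i) , there (∈-++⁺ʳ (¬ℛ j) (here refl)) , tt , li p
        ... | no ¬li = neg (S i j) , here refl , (λ li _ → contradiction li ¬li) , truth-S-missed Σ lj ¬li
      literal (witness-smaller i j) known = relativized {j} (there ∘ ∈-++⁺ˡ) λ lj → case lj
        where
        i∈ = known (here refl)
        j∈ = known (there (here refl))
        case : Live j → _
        case lj with live? i
        ... | no ¬li = neg (S i j) , here refl , (λ li _ → contradiction li ¬li) , truth-S-missed Σ lj ¬li
        ... | yes li with i Fin.≟ wit Σ j
        ...   | no i≢ = neg (S i j) , here refl , (λ _ _ → j∈) , trans (truth-S Σ li lj) (dec-false (_ Fin.≟ _) i≢)
        -- `i` is the promised witness of `j` and has been queried, so validity puts it below `j`.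
        ...   | yes refl = pos (L i j) , there (∈-++⁺ʳ (¬ℛ j) (here refl)) , (λ _ _ → i∈ , j∈) ,
                           trans (truth-L Σ li lj) (dec-true (_ <? _) (proj₂ (valid j∈) i∈))
      literal (last-relativized i p eq) known = pos (R p i) , here refl , tt , last-live i eq p

-- Disjoint families and covers

_≟ᵛ_ : ∀ {d n} → DecidableEquality (Var d n)
L i j ≟ᵛ L k l = map′ (λ { (refl , refl) → refl }) (λ { refl → refl , refl }) (i Fin.≟ k ×-dec j Fin.≟ l)
S i j ≟ᵛ S k l = map′ (λ { (refl , refl) → refl }) (λ { refl → refl , refl }) (i Fin.≟ k ×-dec j Fin.≟ l)
R p i ≟ᵛ R q j = map′ (λ { (refl , refl) → refl }) (λ { refl → refl , refl }) (p Fin.≟ q ×-dec i Fin.≟ j)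
L i j ≟ᵛ S k l = no λ ()
L i j ≟ᵛ R p k = no λ ()
S i j ≟ᵛ L k l = no λ ()
S i j ≟ᵛ R p k = no λ ()
R p i ≟ᵛ L k l = no λ ()
R p i ≟ᵛ S k l = no λ ()

_≟ˡ_ : ∀ {d n} → DecidableEquality (Literal (Var d n))
pos x ≟ˡ pos y = map′ (cong pos) (λ { refl → refl }) (x ≟ᵛ y)
neg x ≟ˡ neg y = map′ (cong neg) (λ { refl → refl }) (x ≟ᵛ y)
pos x ≟ˡ neg y = no λ ()
neg x ≟ˡ pos y = no λ ()

length-concatMap≤ : ∀ {A B : Set} (f : A → List B) k xs → (∀ {x} → x ∈ xs → length (f x) ≤ k) →
                    length (concatMap f xs) ≤ length xs * k
length-concatMap≤ f k []       f≤k = z≤n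
length-concatMap≤ f k (x ∷ xs) f≤k = ≤-trans (≤-reflexive (length-++ (f x)))
  (+-mono-≤ (f≤k (here refl)) (length-concatMap≤ f k xs (f≤k ∘ there)))

injective⇒≤length : ∀ {A : Set} {k} {xs : List A} (g : Fin k → A) →
  (∀ {i j} → g i ≡ g j → i ≡ j) → (∀ i → g i ∈ xs) → k ≤ length xs
injective⇒≤length {xs = xs} g inj g∈ = ≮⇒≥ λ xs<k →
  let i , j , i<j , eq = Fin.pigeonhole xs<k (index ∘ g∈)
  in Fin.<⇒≢ i<j (inj (trans (Any.lookup-index (g∈ i)) (trans (cong (lookup xs) eq) (sym (Any.lookup-index (g∈ j))))))

module Combinatorics {d n : ℕ} where

  open import Data.List.Membership.DecPropositional (Fin._≟_ {n}) using () renaming (_∈?_ to _∈ᴱ?_)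
  open import Data.List.Membership.DecPropositional (_≟ᵛ_ {d} {n}) using () renaming (_∈?_ to _∈ⱽ?_)
  open import Data.List.Membership.DecPropositional (_≟ˡ_ {d} {n}) using () renaming (_∈?_ to _∈ᴸ?_)

  Elements : Set
  Elements = List (Fin n)

  elements : Var d n → Elements
  elements (L i j) = i ∷ j ∷ []
  elements (S i j) = i ∷ j ∷ []
  elements (R p i) = i ∷ []

  outside : Elements → Conjunction (Var d n) → Elements
  outside K C = filter (λ i → ¬? (i ∈ᴱ? K)) (concatMap (elements ∘ var) C)

  elements≤2 : ∀ v → length (elements v) ≤ 2
  elements≤2 (L i j) = ≤-refl
  elements≤2 (S i j) = ≤-refl
  elements≤2 (R p i) = s≤s z≤n

  length-outside : ∀ K C → length (outside K C) ≤ length C * 2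
  length-outside K C = ≤-trans (length-filter _ (concatMap (elements ∘ var) C))
    (length-concatMap≤ (elements ∘ var) 2 C (λ {ℓ} _ → elements≤2 (var ℓ)))

  ∈-outside⁺ : ∀ {K C ℓ i} → ℓ ∈ C → i ∈ elements (var ℓ) → i ∉ K → i ∈ outside K C
  ∈-outside⁺ {K} ℓ∈C i∈ℓ i∉K = ∈-filter⁺ (λ i → ¬? (i ∈ᴱ? K))
    (∈-concatMap⁺ (elements ∘ var) (lose ℓ∈C i∈ℓ)) i∉K

  ∈-outside⁻ : ∀ {K C i} → i ∈ outside K C → i ∉ K
  ∈-outside⁻ {K} {C} i∈ = proj₂ (∈-filter⁻ (λ i → ¬? (i ∈ᴱ? K)) {xs = concatMap (elements ∘ var) C} i∈)

  Inside : Elements → Var d n → Set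
  Inside K v = All (_∈ K) (elements v)

  inside? : ∀ K → Decidable (Inside K)
  inside? K v = All.all? (_∈ᴱ? K) (elements v)

  -- An explicit list, because the possible truth values inside `K` are enumerated as its sublists.
  insideVars : Elements → List (Var d n)
  insideVars K = concatMap (λ i → map (λ p → R p i) (allFin d)) K
              ++ concatMap (λ i → map (L i) K) K ++ concatMap (λ i → map (S i) K) K

  ∈-insideVars : ∀ {K} v → Inside K v → v ∈ insideVars K
  ∈-insideVars (R p i) (i∈ ∷ []) = ∈-++⁺ˡ
    (∈-concatMap⁺ (λ i → map (λ p → R p i) (allFin d)) (lose i∈ (∈-map⁺ (λ p → R p i) (∈-allFin p))))
  ∈-insideVars {K} (L i j) (i∈ ∷ j∈ ∷ []) = ∈-++⁺ʳ (concatMap (λ i → map (λ p → R p i) (allFin d)) K)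
    (∈-++⁺ˡ (∈-concatMap⁺ (λ i → map (L i) K) (lose i∈ (∈-map⁺ (L i) j∈))))
  ∈-insideVars {K} (S i j) (i∈ ∷ j∈ ∷ []) = ∈-++⁺ʳ (concatMap (λ i → map (λ p → R p i) (allFin d)) K)
    (∈-++⁺ʳ (concatMap (λ i → map (L i) K) K) (∈-concatMap⁺ (λ i → map (S i) K) (lose i∈ (∈-map⁺ (S i) j∈))))

  ∈-insideVars⁻ : ∀ {K} v → v ∈ insideVars K → Inside K v
  ∈-insideVars⁻ {K} v v∈ with ∈-++⁻ (concatMap (λ i → map (λ p → R p i) (allFin d)) K) v∈
  ... | inj₁ ∈R with i , i∈ , v∈i ← find (∈-concatMap⁻ (λ i → map (λ p → R p i) (allFin d)) {xs = K} ∈R)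
                with _ , _ , refl ← ∈-map⁻ (λ p → R p i) v∈i = i∈ ∷ []
  ... | inj₂ ∈LS with ∈-++⁻ (concatMap (λ i → map (L i) K) K) ∈LS
  ...   | inj₁ ∈L with i , i∈ , v∈i ← find (∈-concatMap⁻ (λ i → map (L i) K) {xs = K} ∈L)
                  with _ , j∈ , refl ← ∈-map⁻ (L i) v∈i = i∈ ∷ j∈ ∷ []
  ...   | inj₂ ∈S with i , i∈ , v∈i ← find (∈-concatMap⁻ (λ i → map (S i) K) {xs = K} ∈S)
                  with _ , j∈ , refl ← ∈-map⁻ (S i) v∈i = i∈ ∷ j∈ ∷ []

  length-insideVars : ∀ K → length (insideVars K) ≤ length K * d + (length K * length K + length K * length K)
  length-insideVars K = ≤-trans (≤-reflexive (trans (length-++ Rs) (cong (length Rs +_) (length-++ Ls))))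
    (+-mono-≤ (bound (λ i → map (λ p → R p i) (allFin d)) d λ {i} _ →
                 ≤-reflexive (trans (length-map (λ p → R p i) (allFin d)) (length-tabulate id)))
      (+-mono-≤ (bound (λ i → map (L i) K) (length K) λ {i} _ → ≤-reflexive (length-map (L i) K))
                (bound (λ i → map (S i) K) (length K) λ {i} _ → ≤-reflexive (length-map (S i) K))))
    where
    Rs = concatMap (λ i → map (λ p → R p i) (allFin d)) K
    Ls = concatMap (λ i → map (L i) K) K
    bound : (f : Fin n → List (Var d n)) (k : ℕ) → (∀ {i} → i ∈ K → length (f i) ≤ k) →
            length (concatMap f K) ≤ length K * k
    bound f k = length-concatMap≤ f k K

  -- T is the set of variables inside K that are taken to be true.
  TrueIn : List (Var d n) → Literal (Var d n) → Set
  TrueIn T (pos v) = v ∈ T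
  TrueIn T (neg v) = v ∉ T

  trueIn? : ∀ T → Decidable (TrueIn T)
  trueIn? T (pos v) = v ∈ⱽ? T
  trueIn? T (neg v) = ¬? (v ∈ⱽ? T)

  -- Only an element that is not relativized could satisfy such a literal.
  Escapes : Elements → List (Var d n) → Literal (Var d n) → Set
  Escapes K T (pos (S i j)) = j ∈ K × i ∉ K × (∀ p → R p j ∈ T)
  Escapes K T _             = ⊥

  escapes? : ∀ K T → Decidable (Escapes K T)
  escapes? K T (pos (S i j)) = j ∈ᴱ? K ×-dec ¬? (i ∈ᴱ? K) ×-dec Fin.all? (λ p → R p j ∈ⱽ? T)
  escapes? K T (pos (L i j)) = no id
  escapes? K T (pos (R p i)) = no id
  escapes? K T (neg v)       = no id

  Admissible : Elements → List (Var d n) → Literal (Var d n) → Set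
  Admissible K T ℓ = (Inside K (var ℓ) → TrueIn T ℓ) × ¬ Escapes K T ℓ

  admissible? : ∀ K T → Decidable (Admissible K T)
  admissible? K T ℓ = (inside? K (var ℓ) →-dec trueIn? T ℓ) ×-dec ¬? (escapes? K T ℓ)

  Good : Elements → List (Var d n) → Conjunction (Var d n) → Set
  Good K T C = All (λ ℓ → negate ℓ ∉ C) C × All (Admissible K T) C

  consistent? : ∀ C → Dec (All (λ ℓ → negate ℓ ∉ C) C)
  consistent? C = All.all? (λ ℓ → ¬? (negate ℓ ∈ᴸ? C)) C

  good? : ∀ K T → Decidable (Good K T)
  good? K T C = consistent? C ×-dec All.all? (admissible? K T) C

  -- Makes the outside part of C true by removing from the relativization all
  -- outside elements, except for the one of a term C = R¹ᵢ ∧ … ∧ Rᵈᵢ.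
  demand : Elements → Conjunction (Var d n) → List (Literal (Var d n))
  demand K C = filter (λ ℓ → ¬? (negate ℓ ∈ᴸ? C))
    (filter (λ ℓ → ¬? (inside? K (var ℓ))) C ++ concatMap ¬ℛ (outside K C))

  ∈-demand-outside : ∀ {K C ℓ} → ℓ ∈ C → negate ℓ ∉ C → ¬ Inside K (var ℓ) → ℓ ∈ demand K C
  ∈-demand-outside {K} {C} ℓ∈C ¬ℓ∉C out = ∈-filter⁺ (λ ℓ → ¬? (negate ℓ ∈ᴸ? C))
    (∈-++⁺ˡ (∈-filter⁺ (λ ℓ → ¬? (inside? K (var ℓ))) ℓ∈C out)) ¬ℓ∉C

  ∈-demand-¬R : ∀ {K C i} p → i ∈ outside K C → pos (R p i) ∉ C → neg (R p i) ∈ demand K C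
  ∈-demand-¬R {K} {C} p i∈ ∉C = ∈-filter⁺ (λ ℓ → ¬? (negate ℓ ∈ᴸ? C))
    (∈-++⁺ʳ (filter (λ ℓ → ¬? (inside? K (var ℓ))) C)
      (∈-concatMap⁺ ¬ℛ (lose i∈ (∈-map⁺ (λ p → neg (R p _)) (∈-allFin p))))) ∉C

  ∈-demand⁻ : ∀ {K C ℓ} → ℓ ∈ demand K C → negate ℓ ∉ C ×
    (ℓ ∈ C × ¬ Inside K (var ℓ) ⊎ ∃[ i ] ∃[ p ] i ∈ outside K C × ℓ ≡ neg (R p i))
  ∈-demand⁻ {K} {C} ℓ∈ with ∈raw , ¬ℓ∉C ← ∈-filter⁻ (λ ℓ → ¬? (negate ℓ ∈ᴸ? C))
                              {xs = filter (λ ℓ → ¬? (inside? K (var ℓ))) C ++ concatMap ¬ℛ (outside K C)} ℓ∈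
    with ∈-++⁻ (filter (λ ℓ → ¬? (inside? K (var ℓ))) C) ∈raw
  ... | inj₁ ∈C = ¬ℓ∉C , inj₁ (∈-filter⁻ (λ ℓ → ¬? (inside? K (var ℓ))) ∈C)
  ... | inj₂ ∈¬ℛ with i , i∈ , ℓ∈¬ℛ ← find (∈-concatMap⁻ ¬ℛ {xs = outside K C} ∈¬ℛ)
                 with p , _ , eq ← ∈-map⁻ (λ p → neg (R p i)) ℓ∈¬ℛ = ¬ℓ∉C , inj₂ (i , p , i∈ , eq)

  length-demand : ∀ K C → length C ≤ d → length (demand K C) ≤ d + d * 2 * d
  length-demand K C C≤d = begin
    length (demand K C)                               ≤⟨ length-filter _ (outs ++ concatMap ¬ℛ (outside K C)) ⟩
    length (outs ++ concatMap ¬ℛ (outside K C))        ≡⟨ length-++ outs ⟩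
    length outs + length (concatMap ¬ℛ (outside K C))  ≤⟨ +-mono-≤ (≤-trans (length-filter _ C) C≤d) deaths ⟩
    d + d * 2 * d                                      ∎
    where
    open ≤-Reasoning
    outs = filter (λ ℓ → ¬? (inside? K (var ℓ))) C
    deaths : length (concatMap (¬ℛ {d}) (outside K C)) ≤ d * 2 * d
    deaths = ≤-trans
      (length-concatMap≤ ¬ℛ d (outside K C) λ {i} _ →
        ≤-reflexive (trans (length-map (λ p → neg (R p i)) (allFin d)) (length-tabulate id)))
      (*-monoˡ-≤ d (≤-trans (length-outside K C) (*-monoˡ-≤ 2 C≤d)))

  consistent-demand : ∀ K C → Consistent (demand K C)
  consistent-demand K C {ℓ} ℓ∈ ¬ℓ∈ with ∈-demand⁻ {K} {C} ℓ∈ | ∈-demand⁻ {K} {C} ¬ℓ∈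
  ... | _ , inj₁ (ℓ∈C , _) | ¬¬ℓ∉C , _ = ¬¬ℓ∉C (subst (_∈ C) (sym (negate-negate ℓ)) ℓ∈C)
  ... | ¬ℓ∉C , inj₂ _ | _ , inj₁ (¬ℓ∈C , _) = ¬ℓ∉C ¬ℓ∈C
  ... | _ , inj₂ (i , p , _ , refl) | _ , inj₂ (_ , _ , _ , ())

  -- Has two uses: a variable demanded for two terms yields a common outside element, which
  -- disjointness forbids; and no `R p last` is demanded when `last` belongs to `K`.
  demand-outside : ∀ {K C v} → v ∈ map var (demand K C) →
    (∃[ i ] i ∈ elements v × i ∉ K) × (∀ {i} → i ∈ elements v → i ∉ K → i ∈ outside K C)
  demand-outside {K} {C} v∈ with ℓ , ℓ∈ , refl ← ∈-map⁻ var v∈ with ∈-demand⁻ {K} {C} ℓ∈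
  ... | _ , inj₁ (ℓ∈C , out) = find (All.¬All⇒Any¬ (_∈ᴱ? K) _ out) , ∈-outside⁺ ℓ∈C
  ... | _ , inj₂ (i , p , i∈ , refl) = (i , here refl , ∈-outside⁻ {K} {C} i∈) , λ { (here refl) _ → i∈ }

  DisjointOutside : Elements → Conjunction (Var d n) → Conjunction (Var d n) → Set
  DisjointOutside K C D = ∀ {i} → i ∈ outside K C → i ∉ outside K D

  disjoint-demand : ∀ {K C D} → DisjointOutside K C D → DisjointVars (demand K C) (demand K D)
  disjoint-demand {K} {C} {D} dis v∈C v∈D
    with (i , i∈v , i∉K) , _ ← demand-outside {K} {C} v∈C =
    dis (proj₂ (demand-outside {K} {C} v∈C) i∈v i∉K) (proj₂ (demand-outside {K} {D} v∈D) i∈v i∉K)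

  module Greedy (F : DNF (Var d n)) (narrow : All (λ C → length C ≤ d) F)
                (K : Elements) (T : List (Var d n)) where

    record Heavy (t : ℕ) (U : Elements) : Set where
      field
        terms    : DNF (Var d n)
        number   : length terms ≡ t
        good     : All (λ C → C ∈ F × Good K T C) terms
        avoid    : All (λ C → All (_∉ U) (outside K C)) terms
        disjoint : AllPairs (DisjointOutside K) terms

    record Light (t : ℕ) (U : Elements) (Cs : DNF (Var d n)) : Set where
      field
        cover   : Elements
        small   : length cover ≤ length U + t * (d * 2)
        ⊆-cover : ∀ {i} → i ∈ U → i ∈ cover
        covers  : ∀ {C} → C ∈ Cs → Good K T C → ∀ {i} → i ∈ outside K C →
                  ∃[ j ] j ∈ outside K C × j ∈ cover

    -- A good term avoiding `U` is picked, and its at most `2 * d` outside elements join `U`. Either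
    -- `t` picks succeed, or the process stops early and the accumulated `U` meets every good term
    -- that still has an outside element.
    greedy : ∀ t U Cs → (∀ {C} → C ∈ Cs → C ∈ F) → Heavy t U ⊎ Light t U Cs
    greedy zero U Cs Cs⊆F = inj₁ record
      { terms = [] ; number = refl ; good = [] ; avoid = [] ; disjoint = [] }
    greedy (suc t) U [] Cs⊆F = inj₂ record
      { cover = U ; small = m≤m+n _ _ ; ⊆-cover = id ; covers = λ () }
    greedy (suc t) U (C ∷ Cs) Cs⊆F with good? K T C ×-dec All.all? (λ i → ¬? (i ∈ᴱ? U)) (outside K C)
    greedy (suc t) U (C ∷ Cs) Cs⊆F | yes (gC , avoidsC) with greedy t (outside K C ++ U) Cs (Cs⊆F ∘ there)
    ... | inj₁ h = inj₁ record
      { terms    = C ∷ terms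
      ; number   = cong suc number
      ; good     = (Cs⊆F (here refl) , gC) ∷ good
      ; avoid    = avoidsC ∷ All.map (All.map (λ i∉ → i∉ ∘ ∈-++⁺ʳ (outside K C))) avoid
      ; disjoint = All.map (λ av {i} i∈C i∈D → All.lookup av i∈D (∈-++⁺ˡ i∈C)) avoid ∷ disjoint
      } where open Heavy h
    ... | inj₂ l = inj₂ record
      { cover   = cover
      ; small   = begin
          length cover                                 ≤⟨ small ⟩
          length (outside K C ++ U) + t * (d * 2)      ≡⟨ cong (_+ t * (d * 2)) (length-++ (outside K C)) ⟩
          length (outside K C) + length U + t * (d * 2) ≤⟨ +-monoˡ-≤ (t * (d * 2)) (+-monoˡ-≤ (length U) outC) ⟩
          d * 2 + length U + t * (d * 2)               ≡⟨ cong (_+ t * (d * 2)) (+-comm (d * 2) (length U)) ⟩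
          length U + d * 2 + t * (d * 2)               ≡⟨ +-assoc (length U) (d * 2) _ ⟩
          length U + suc t * (d * 2)                   ∎
      ; ⊆-cover = ⊆-cover ∘ ∈-++⁺ʳ (outside K C)
      ; covers  = λ { (here refl) _ {i} i∈ → i , i∈ , ⊆-cover (∈-++⁺ˡ i∈) ; (there D∈) → covers D∈ }
      }
      where
      open Light l
      open ≤-Reasoning
      outC : length (outside K C) ≤ d * 2
      outC = ≤-trans (length-outside K C) (*-monoˡ-≤ 2 (All.lookup narrow (Cs⊆F (here refl))))
    greedy (suc t) U (C ∷ Cs) Cs⊆F | no ¬eligible with greedy (suc t) U Cs (Cs⊆F ∘ there)
    ... | inj₁ h = inj₁ h
    ... | inj₂ l = inj₂ record
      { cover = cover ; small = small ; ⊆-cover = ⊆-cover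
      ; covers = λ { (here refl) gC _ → met gC ; (there D∈) → covers D∈ } }
      where
      open Light l
      met : Good K T C → ∃[ j ] j ∈ outside K C × j ∈ cover
      met gC with j , j∈ , ¬j∉U ← find (All.¬All⇒Any¬ (λ i → ¬? (i ∈ᴱ? U)) _ (λ av → ¬eligible (gC , av))) =
        j , j∈ , ⊆-cover (decidable-stable (j ∈ᴱ? U) ¬j∉U)

    heavy-test : ∀ {t U} (h : Heavy t U) → Test (d + d * 2 * d) t (map (demand K) (Heavy.terms h))
    heavy-test h = record
      { number     = trans (length-map (demand K) terms) number
      ; widths     = All.map⁺ (All.map (λ {C} (C∈F , _) → length-demand K C (All.lookup narrow C∈F)) good)
      ; consistent = All.map⁺ (All.universal (λ C {ℓ} → consistent-demand K C {ℓ}) terms)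
      ; disjoint   = AllPairs.map⁺ (AllPairs.map {R = DisjointOutside K} (λ {C} {D} (dis : DisjointOutside K C D) {x} → disjoint-demand {K} {C} {D} dis {x}) disjoint)
      } where open Heavy h

sublists : ∀ {A : Set} → List A → List (List A)
sublists []       = [ [] ]
sublists (x ∷ xs) = map (x ∷_) (sublists xs) ++ sublists xs

filter∈sublists : ∀ {A : Set} {P : A → Set} (P? : ∀ x → Dec (P x)) xs → filter P? xs ∈ sublists xs
filter∈sublists P? []       = here refl
filter∈sublists P? (x ∷ xs) with P? x
... | yes _ = ∈-++⁺ˡ (∈-map⁺ (x ∷_) (filter∈sublists P? xs))
... | no  _ = ∈-++⁺ʳ (map (x ∷_) (sublists xs)) (filter∈sublists P? xs)

-- A further entry `y`, together with the values of `f`, would give `d + 1` distinct entries of a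
-- list of length at most `d`.
covered : ∀ {A : Set} {d} {xs : List A} (_≟_ : (x y : A) → Dec (x ≡ y)) (f : Fin d → A) →
  (∀ {p q} → f p ≡ f q → p ≡ q) → length xs ≤ d → (∀ p → f p ∈ xs) → ∀ {y} → y ∈ xs → ∃[ p ] y ≡ f p
covered {A} {d} {xs} _≟_ f inj xs≤d f∈ {y} y∈ = decidable-stable (Fin.any? λ p → y ≟ f p) λ y∉ →
  let g : Fin (suc d) → A
      g = λ { zero → y ; (suc p) → f p }
      g-inj : ∀ {i j} → g i ≡ g j → i ≡ j
      g-inj = λ { {zero} {zero} _ → refl ; {zero} {suc q} eq → contradiction (q , eq) y∉
                ; {suc p} {zero} eq → contradiction (p , sym eq) y∉ ; {suc p} {suc q} eq → cong suc (inj eq) }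
  in <⇒≱ (s≤s xs≤d) (injective⇒≤length g g-inj λ { zero → y∈ ; (suc p) → f∈ p })

filter-truth-cong : ∀ {A : Set} (f g : A → Bool) xs → (∀ {x} → x ∈ xs → f x ≡ g x) →
                    filter (λ x → f x Bool.≟ true) xs ≡ filter (λ x → g x Bool.≟ true) xs
filter-truth-cong f g []       same = refl
filter-truth-cong f g (x ∷ xs) same rewrite same (here refl) with g x
... | true  = cong (x ∷_) (filter-truth-cong f g xs (same ∘ there))
... | false = filter-truth-cong f g xs (same ∘ there)

-- Terms made true by the restriction

module Decision {d n : ℕ} (β : Var d n → Bool) where

  open Semantics {d} {n} β
  open Combinatorics {d} {n}
  open import Data.List.Membership.DecPropositional (Fin._≟_ {n}) using (_∈?_)
  open import Data.List.Membership.DecPropositional (_≟ˡ_ {d} {n}) using () renaming (_∈?_ to _∈ᴸ?_)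

  trueVars : State → Elements → List (Var d n)
  trueVars Σ K = filter (λ v → truth Σ v Bool.≟ true) (insideVars K)

  inside-determined : ∀ {Σ K} → (∀ {i} → i ∈ K → i ∈ queried Σ) → ∀ v → Inside K v → Determined Σ v
  inside-determined K⊆ (R p i) _               = tt
  inside-determined K⊆ (L i j) (i∈ ∷ j∈ ∷ [])  = λ _ _ → K⊆ i∈ , K⊆ j∈
  inside-determined K⊆ (S i j) (i∈ ∷ j∈ ∷ [])  = λ _ _ → K⊆ j∈

  trueIn⇒satisfies : ∀ Σ K ℓ → Inside K (var ℓ) → TrueIn (trueVars Σ K) ℓ → Satisfies (truth Σ) ℓ
  trueIn⇒satisfies Σ K (pos v) ins v∈ = proj₂ (∈-filter⁻ (λ v → truth Σ v Bool.≟ true) {xs = insideVars K} v∈)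
  trueIn⇒satisfies Σ K (neg v) ins v∉ = Bool.¬-not λ t →
    v∉ (∈-filter⁺ (λ v → truth Σ v Bool.≟ true) (∈-insideVars v ins) t)

  ¬trueIn⇒satisfies : ∀ Σ K ℓ → Inside K (var ℓ) → ¬ TrueIn (trueVars Σ K) ℓ → Satisfies (truth Σ) (negate ℓ)
  ¬trueIn⇒satisfies Σ K (pos v) ins v∉ = trueIn⇒satisfies Σ K (neg v) ins v∉
  ¬trueIn⇒satisfies Σ K (neg v) ins ¬v∉ =
    trueIn⇒satisfies Σ K (pos v) ins (decidable-stable (trueIn? (trueVars Σ K) (pos v)) ¬v∉)

  trueVars-live : ∀ {Σ K j} → (∀ p → R p j ∈ trueVars Σ K) → Live j
  trueVars-live {Σ} {K} R∈ p = proj₂ (∈-filter⁻ (λ v → truth Σ v Bool.≟ true) {xs = insideVars K} (R∈ p))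

  live-trueVars : ∀ {Σ K j} → j ∈ K → Live j → ∀ p → R p j ∈ trueVars Σ K
  live-trueVars {Σ} j∈ lj p = ∈-filter⁺ (λ v → truth Σ v Bool.≟ true) (∈-insideVars (R p _) (j∈ ∷ [])) (lj p)

  -- If C contains all Rᵖᵢ for an outside element i then C has no other literals.
  demand-kills : ∀ {K C ℓ i} → length C ≤ d → All (Satisfies β) (demand K C) → ℓ ∈ C →
                 (∀ {p j} → ℓ ≢ pos (R p j)) → i ∈ outside K C → ¬ Live i
  demand-kills {K} {C} {ℓ} {i} C≤d sat ℓ∈C ℓ≢R i∈ li
    with Fin.any? (λ p → ¬? (pos (R p i) ∈ᴸ? C))
  ... | yes (p , Rp∉) with () ← trans (sym (li p)) (All.lookup sat (∈-demand-¬R {K} {C} p i∈ Rp∉))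
  ... | no all∈ with p , eq ← covered _≟ˡ_ (λ p → pos (R p i)) (λ { refl → refl }) C≤d
                         (λ p → decidable-stable (pos (R p i) ∈ᴸ? C) (λ Rp∉ → all∈ (p , Rp∉))) ℓ∈C = ℓ≢R eq

  -- Literals inside `K` are true by admissibility, and outside `R` literals by `β`. An `L` or `S`
  -- literal with an outside element has that element dead, so it is determined and takes its value
  -- from `β`, unless it is about `S i j` with `j` live in `K`: then the positive literal is
  -- inadmissible, and the negative one holds because `i` is dead.
  demand-true : ∀ {Σ K C} → (∀ {i} → i ∈ K → i ∈ queried Σ) → Good K (trueVars Σ K) C → length C ≤ d →
                All (Satisfies β) (demand K C) → TrueTerm Σ C
  demand-true {Σ} {K} {C} K⊆ (consistent , admissible) C≤d sat = All.tabulate holds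
    where
    holds : ∀ {ℓ} → ℓ ∈ C → Holds Σ ℓ
    outer : ∀ ℓ → ℓ ∈ C → ¬ Inside K (var ℓ) → Satisfies β ℓ → Holds Σ ℓ
    holds {ℓ} ℓ∈C with inside? K (var ℓ)
    ... | yes ins = inside-determined {Σ} K⊆ (var ℓ) ins ,
                    trueIn⇒satisfies Σ K ℓ ins (proj₁ (All.lookup admissible ℓ∈C) ins)
    ... | no out  = outer ℓ ℓ∈C out
                      (All.lookup sat (∈-demand-outside ℓ∈C (All.lookup consistent ℓ∈C) out))
    dead : ∀ {ℓ i} → ℓ ∈ C → (∀ {p j} → ℓ ≢ pos (R p j)) → i ∈ elements (var ℓ) → i ∉ K → ¬ Live i
    dead ℓ∈C ℓ≢R i∈ℓ i∉K = demand-kills {K} {C} C≤d sat ℓ∈C ℓ≢R (∈-outside⁺ ℓ∈C i∈ℓ i∉K)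
    dead-L : ∀ {i j ℓ} → ℓ ∈ C → (∀ {p k} → ℓ ≢ pos (R p k)) → elements (var ℓ) ≡ i ∷ j ∷ [] →
             ¬ Inside K (L i j) → ¬ Live i ⊎ ¬ Live j
    dead-L {i} {j} ℓ∈C ℓ≢R eq out with i ∈? K
    ... | no i∉K  = inj₁ (dead ℓ∈C ℓ≢R (subst (i ∈_) (sym eq) (here refl)) i∉K)
    ... | yes i∈K = inj₂ (dead ℓ∈C ℓ≢R (subst (j ∈_) (sym eq) (there (here refl)))
                               (λ j∈K → out (i∈K ∷ j∈K ∷ [])))
    outer (pos (R p i)) ℓ∈C out s = tt , s
    outer (neg (R p i)) ℓ∈C out s = tt , s
    outer (pos (L i j)) ℓ∈C out s with dead-L {ℓ = pos (L i j)} ℓ∈C (λ ()) refl out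
    ... | del = (λ li lj → ⊥-elim ([ (λ ¬li → ¬li li) , (λ ¬lj → ¬lj lj) ]′ del)) , trans (truth-L-dead Σ del) s
    outer (neg (L i j)) ℓ∈C out s with dead-L {ℓ = neg (L i j)} ℓ∈C (λ ()) refl out
    ... | del = (λ li lj → ⊥-elim ([ (λ ¬li → ¬li li) , (λ ¬lj → ¬lj lj) ]′ del)) , trans (truth-L-dead Σ del) s
    outer (pos (S i j)) ℓ∈C out s with j ∈? K
    ... | no j∉K = let ¬lj = dead ℓ∈C (λ ()) (there (here refl)) j∉K in
                   (λ _ lj → contradiction lj ¬lj) , trans (truth-S-dead Σ ¬lj) s
    ... | yes j∈K with toSum (live? j)
    ...   | inj₂ ¬lj = (λ _ lj → contradiction lj ¬lj) , trans (truth-S-dead Σ ¬lj) s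
    ...   | inj₁ lj = ⊥-elim (proj₂ (All.lookup admissible ℓ∈C)
                       (j∈K , (λ i∈K → out (i∈K ∷ j∈K ∷ [])) , live-trueVars {Σ} j∈K lj))
    outer (neg (S i j)) ℓ∈C out s with j ∈? K
    ... | no j∉K = let ¬lj = dead ℓ∈C (λ ()) (there (here refl)) j∉K in
                   (λ _ lj → contradiction lj ¬lj) , trans (truth-S-dead Σ ¬lj) s
    ... | yes j∈K with toSum (live? j)
    ...   | inj₂ ¬lj = (λ _ lj → contradiction lj ¬lj) , trans (truth-S-dead Σ ¬lj) s
    ...   | inj₁ lj = let ¬li = dead ℓ∈C (λ ()) (here refl) (λ i∈K → out (i∈K ∷ j∈K ∷ [])) in
                     (λ li _ → contradiction li ¬li) , truth-S-missed Σ lj ¬li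

  outside-shrinks : ∀ {K} C {i} → i ∈ outside K C → length (outside (i ∷ K) C) < length (outside K C)
  outside-shrinks {K} C {i} i∈ = shrinks (concatMap (elements ∘ var) C) (∈-filter⁻ (λ i → ¬? (i ∈? K)) i∈)
    where
    left : Elements → Elements → Elements
    left K = filter (λ i → ¬? (i ∈? K))
    shorter : ∀ xs → length (left (i ∷ K) xs) ≤ length (left K xs)
    shorter [] = z≤n
    shorter (x ∷ xs) with x ∈? K | x Fin.≟ i
    ... | yes _ | yes _ = shorter xs
    ... | yes _ | no  _ = shorter xs
    ... | no  _ | yes _ = m≤n⇒m≤1+n (shorter xs)
    ... | no  _ | no  _ = s≤s (shorter xs)
    shrinks : ∀ xs → i ∈ xs × i ∉ K → length (left (i ∷ K) xs) < length (left K xs)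
    shrinks (x ∷ xs) (x∈ , i∉K) with x ∈? K | x Fin.≟ i
    shrinks (x ∷ xs) (here refl , i∉K) | yes x∈K | _ = contradiction x∈K i∉K
    shrinks (x ∷ xs) (there i∈ , i∉K) | yes _ | yes _ = shrinks xs (i∈ , i∉K)
    shrinks (x ∷ xs) (there i∈ , i∉K) | yes _ | no  _ = shrinks xs (i∈ , i∉K)
    shrinks (x ∷ xs) _ | no  _ | yes _ = s≤s (shorter xs)
    shrinks (x ∷ xs) (here refl , i∉K) | no  _ | no x≢x = contradiction refl x≢x
    shrinks (x ∷ xs) (there i∈ , i∉K) | no  _ | no  _ = s≤s (shrinks xs (i∈ , i∉K))

-- Deciding a line

fresh : ∀ {A : Set} {B} (_≟_ : (x y : A) → Dec (x ≡ y)) (g : Fin B → A) → (∀ {b c} → g b ≡ g c → b ≡ c) →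
        ∀ ys → length ys < B → ∃[ b ] g b ∉ ys
fresh _≟_ g inj ys few with Fin.any? (λ b → ¬? (Any.any? (g b ≟_) ys))
... | yes found = found
... | no all∈   = contradiction few (≤⇒≯ (injective⇒≤length g inj λ b →
  decidable-stable (Any.any? (g b ≟_) ys) (λ ∉ys → all∈ (b , ∉ys))))

-- The sum `m + m ^ 2 + ... + m ^ f`: the nodes other than the root in a tree of depth `f` and
-- branching `m`.
nodeBound : ℕ → ℕ → ℕ
nodeBound m zero    = 0
nodeBound m (suc f) = m * suc (nodeBound m f)

-- Nodes of the search through a line F are lists K of queried elements, in
-- which the terms of F have been simplified.  Each step to a child K ∪ {x}
-- moves an element of the term under consideration into K, and so the depth
-- is at most 2 d.
module Search {d n : ℕ} (β : Var d n → Bool) (last : Fin n) (t : ℕ)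
              (F : DNF (Var d n)) (narrow : All (λ C → length C ≤ d) F) where

  open Semantics {d} {n} β
  open Combinatorics {d} {n}
  open Decision {d} {n} β
  open Greedy F narrow

  depth : ℕ
  depth = d * 2

  open import Data.List.Membership.DecPropositional (Fin._≟_ {n}) using (_∈?_)
  open import Data.List.Membership.DecPropositional (_≟ˡ_ {d} {n}) using () renaming (_∈?_ to _∈ᴸ?_)

  outcome : ∀ K T → Heavy K T t [] ⊎ Light K T t [] F
  outcome K T = greedy K T t [] F id

  coverOf : ∀ {K T} → Heavy K T t [] ⊎ Light K T t [] F → Elements
  coverOf (inj₁ _) = []
  coverOf (inj₂ l) = Light.cover l

  -- The witnesses of `K` take care of literals `S i j` with `j` live in `K` and `i` outside, which
  -- are false unless `i` is the witness of `j`.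
  children : Elements → State → Elements
  children K Σ = coverOf (outcome K (trueVars Σ K)) ++ map (wit Σ) K

  -- `t * depth` bounds the cover; `suc depth` bounds the node, which starts as `[ last ]` and grows
  -- at most `depth` times.
  width : ℕ
  width = t * depth + suc depth

  length-coverOf : ∀ {K T} (o : Heavy K T t [] ⊎ Light K T t [] F) → length (coverOf o) ≤ t * depth
  length-coverOf (inj₁ _) = z≤n
  length-coverOf (inj₂ l) = Light.small l

  length-children : ∀ K Σ → length K ≤ suc depth → length (children K Σ) ≤ width
  length-children K Σ K≤ = ≤-trans
    (≤-reflexive (trans (length-++ (coverOf (outcome K (trueVars Σ K)))) (cong (length (coverOf (outcome K (trueVars Σ K))) +_) (length-map (wit Σ) K))))
    (+-mono-≤ (length-coverOf (outcome K (trueVars Σ K))) K≤)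

  -- Children depend on the values inside `K` and the witnesses of `K` only. All these are settled
  -- once `K` is queried, so later queries do not change the search tree.
  children-cong : ∀ {Σ Σ′ K} → Σ ⊑ Σ′ → (∀ {i} → i ∈ K → i ∈ queried Σ) → children K Σ ≡ children K Σ′
  children-cong {Σ} {Σ′} {K} e K⊆ = cong₂ _++_
    (cong (λ T → coverOf (outcome K T)) (filter-truth-cong (truth Σ) (truth Σ′) (insideVars K)
      λ {v} v∈ → sym (truth-mono e v (inside-determined {Σ} K⊆ v (∈-insideVars⁻ v v∈)))))
    (map-cong-local (All.tabulate λ i∈ → sym (wit-same e (K⊆ i∈))))

  -- `G` contains the elements added along every branch of length at most `f` below `K`; the
  -- branching depends on `Σ` through the values and witnesses at each node.
  Closed : ℕ → Elements → State → Elements → Set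
  Closed zero    K Σ G = ⊤
  Closed (suc f) K Σ G = ∀ {x} → x ∈ children K Σ → x ∈ G × Closed f (x ∷ K) Σ G

  closed-extend : ∀ f {Σ Σ′ K G} → Σ ⊑ Σ′ → (∀ {i} → i ∈ K → i ∈ queried Σ) →
    (∀ {i} → i ∈ G → i ∈ queried Σ) → Closed f K Σ G → Closed f K Σ′ G
  closed-extend zero    e K⊆ G⊆ c = tt
  closed-extend (suc f) e K⊆ G⊆ c x∈
    with x∈G , cx ← c (subst (_ ∈_) (sym (children-cong e K⊆)) x∈) =
    x∈G , closed-extend f e (λ { (here refl) → G⊆ x∈G ; (there i∈) → K⊆ i∈ }) G⊆ cx

  closed-restrict : ∀ f {Σ Σ′ K G} → Σ ⊑ Σ′ → (∀ {i} → i ∈ K → i ∈ queried Σ) →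
    (∀ {i} → i ∈ G → i ∈ queried Σ) → Closed f K Σ′ G → Closed f K Σ G
  closed-restrict zero    e K⊆ G⊆ c = tt
  closed-restrict (suc f) e K⊆ G⊆ c x∈
    with x∈G , cx ← c (subst (_ ∈_) (children-cong e K⊆) x∈) =
    x∈G , closed-restrict f e (λ { (here refl) → G⊆ x∈G ; (there i∈) → K⊆ i∈ }) G⊆ cx

  closed-weaken : ∀ f {Σ K G G′} → (∀ {i} → i ∈ G → i ∈ G′) → Closed f K Σ G → Closed f K Σ G′
  closed-weaken zero    G⊆ c    = tt
  closed-weaken (suc f) G⊆ c x∈ = let x∈G , cx = c x∈ in G⊆ x∈G , closed-weaken f G⊆ cx

  -- All `K` and `T` are considered because `β` is chosen before any state of the adversary is
  -- known. Nodes contain `last` so that demands never concern `R p last`, whose value is forced.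
  AllHit : Set
  AllHit = ∀ K T → length K ≤ suc depth → T ∈ sublists (insideVars K) → last ∈ K →
           ∀ h → outcome K T ≡ inj₁ h → Hits β (map (demand K) (Heavy.terms h))

  module _ (all-hit : AllHit) where

    -- Induction on `f`, a bound on the elements of `C` outside `K`. An inconsistent or inadmissible
    -- `C` is false, unless it has a literal `S i j` naming the witness of `j`. For a good `C`,
    -- either there is a heavy family, a member of which is true by `β`, or `C` lies inside `K` and
    -- is true, or `C` meets the cover. In the witness and cover cases an element of `C` is a child,
    -- and the search moves there.
    decide-term : ∀ f {K Σ G C} → (∀ {i} → i ∈ K → i ∈ queried Σ) → (∀ {i} → i ∈ G → i ∈ queried Σ) →
      last ∈ K → length K + f ≤ suc depth → Closed f K Σ G → C ∈ F → length (outside K C) ≤ f →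
      TrueDNF Σ F ⊎ FalseTerm Σ C
    decide-term f {K} {Σ} {G} {C} K⊆ G⊆ last∈ K≤ closed C∈F C≤f = split (consistent? C)
      where
      T = trueVars Σ K

      descend : ∀ f {x} → length K + f ≤ suc depth → Closed f K Σ G → length (outside K C) ≤ f →
                x ∈ children K Σ → x ∈ outside K C → TrueDNF Σ F ⊎ FalseTerm Σ C
      descend zero K≤ closed C≤f x∈ x∈out with () ← ≤-trans (outside-shrinks {K} C x∈out) C≤f
      descend (suc f) {x} K≤ closed C≤f x∈ x∈out with x∈G , cx ← closed x∈ =
        decide-term f (λ { (here refl) → G⊆ x∈G ; (there i∈) → K⊆ i∈ }) G⊆ (there last∈)
          (≤-trans (≤-reflexive (sym (+-suc (length K) f))) K≤) cx C∈F
          (≤-pred (≤-trans (outside-shrinks {K} C x∈out) C≤f))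

      good-case : Good K T C → ∀ o → outcome K T ≡ o → TrueDNF Σ F ⊎ FalseTerm Σ C
      good-case gC (inj₁ h) eq with D , D∈ , sat ← find (Any.map⁻ (all-hit K T (m+n≤o⇒m≤o (length K) K≤)
          (filter∈sublists _ (insideVars K)) last∈ h eq))
        with D∈F , gD ← All.lookup (Heavy.good h) D∈ =
        inj₁ (lose D∈F (demand-true {Σ} {K} {D} K⊆ gD (All.lookup narrow D∈F) sat))
      good-case gC (inj₂ l) eq with All.all? (λ ℓ → inside? K (var ℓ)) C
      ... | yes ins = inj₁ (lose C∈F (All.tabulate λ {ℓ} ℓ∈ →
              inside-determined {Σ} K⊆ (var ℓ) (All.lookup ins ℓ∈) ,
              trueIn⇒satisfies Σ K ℓ (All.lookup ins ℓ∈) (proj₁ (All.lookup (proj₂ gC) ℓ∈) (All.lookup ins ℓ∈))))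
      ... | no ¬ins with ℓ , ℓ∈ , out ← find (All.¬All⇒Any¬ (λ ℓ → inside? K (var ℓ)) _ ¬ins)
          with i , i∈ℓ , i∉K ← find (All.¬All⇒Any¬ (_∈? K) _ out)
          with j , j∈out , j∈ ← Light.covers l C∈F gC (∈-outside⁺ ℓ∈ i∈ℓ i∉K) =
          descend f K≤ closed C≤f (subst (λ o → j ∈ coverOf o ++ map (wit Σ) K) (sym eq) (∈-++⁺ˡ j∈)) j∈out

      escape : ∀ ℓ → ℓ ∈ C → Escapes K T ℓ → TrueDNF Σ F ⊎ FalseTerm Σ C
      escape (pos (S i j)) ℓ∈ (j∈K , i∉K , R∈T) with i Fin.≟ wit Σ j
      ... | yes i≡ = descend f K≤ closed C≤f
              (∈-++⁺ʳ (coverOf (outcome K T)) (subst (_∈ map (wit Σ) K) (sym i≡) (∈-map⁺ (wit Σ) j∈K)))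
              (∈-outside⁺ ℓ∈ (here refl) i∉K)
      ... | no i≢ = inj₂ (inj₁ (lose ℓ∈ ((λ _ _ → K⊆ j∈K) , value (toSum (live? i)))))
        where
        lj = trueVars-live {Σ} {K} R∈T
        value : Live i ⊎ ¬ Live i → truth Σ (S i j) ≡ false
        value (inj₁ li)  = trans (truth-S Σ li lj) (dec-false (i Fin.≟ wit Σ j) i≢)
        value (inj₂ ¬li) = truth-S-missed Σ lj ¬li

      inadmissible : ∀ ℓ → ℓ ∈ C → ¬ Admissible K T ℓ → TrueDNF Σ F ⊎ FalseTerm Σ C
      inadmissible ℓ ℓ∈ ¬adm with escapes? K T ℓ
      ... | yes esc = escape ℓ ℓ∈ esc
      ... | no ¬esc with inside? K (var ℓ)
      ...   | no out  = contradiction ((λ ins → contradiction ins out) , ¬esc) ¬adm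
      ...   | yes ins = inj₂ (inj₁ (lose ℓ∈ (inside-determined {Σ} K⊆ (var ℓ) ins ,
                          ¬trueIn⇒satisfies Σ K ℓ ins (λ t → ¬adm ((λ _ → t) , ¬esc)))))

      split : Dec (All (λ ℓ → negate ℓ ∉ C) C) → TrueDNF Σ F ⊎ FalseTerm Σ C
      split (no inconsistent) with ℓ , ℓ∈ , ¬¬ℓ∈ ← find (All.¬All⇒Any¬ (λ ℓ → ¬? (negate ℓ ∈ᴸ? C)) C inconsistent) =
        inj₂ (inj₂ (ℓ , ℓ∈ , decidable-stable (negate ℓ ∈ᴸ? C) ¬¬ℓ∈))
      split (yes con) with All.all? (admissible? K T) C
      ... | yes adm = good-case (con , adm) (outcome K T) refl
      ... | no ¬adm with ℓ , ℓ∈ , ¬a ← find (All.¬All⇒Any¬ (admissible? K T) C ¬adm) = inadmissible ℓ ℓ∈ ¬a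

    decide : ∀ {Σ G} → last ∈ queried Σ → (∀ {i} → i ∈ G → i ∈ queried Σ) → Closed depth [ last ] Σ G →
             TrueDNF Σ F ⊎ FalseDNF Σ F
    decide {Σ} {G} last∈ G⊆ closed = all-terms F id
      where
      all-terms : ∀ Cs → (∀ {C} → C ∈ Cs → C ∈ F) → TrueDNF Σ F ⊎ FalseDNF Σ Cs
      all-terms []       Cs⊆F = inj₂ []
      all-terms (C ∷ Cs) Cs⊆F with all-terms Cs (Cs⊆F ∘ there)
      ... | inj₁ t = inj₁ t
      ... | inj₂ fs with decide-term depth {[ last ]} {Σ} {G} {C} (λ { (here refl) → last∈ }) G⊆ (here refl)
                           ≤-refl closed (Cs⊆F (here refl))
                           (≤-trans (length-outside [ last ] C) (*-monoˡ-≤ 2 (All.lookup narrow (Cs⊆F (here refl)))))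
      ...   | inj₁ t = inj₁ t
      ...   | inj₂ f = inj₂ (f ∷ fs)

  module _ {B : ℕ} (live : Fin B → Fin n) (live-injective : ∀ {b c} → live b ≡ live c → b ≡ c)
           (live-live : ∀ b → Live (live b)) where

    record Extension (Σ : State) (k : ℕ) (P : State → Elements → Set) : Set where
      field
        Σ′      : State
        valid′  : Valid Σ′
        extends : Σ ⊑ Σ′
        few     : length (queried Σ′) ≤ length (queried Σ) + k
        G       : Elements
        G⊆      : ∀ {i} → i ∈ G → i ∈ queried Σ′
        G-few   : length G ≤ k
        holds   : P Σ′ G

    -- Different terms follow different branches, so the whole tree is queried. The last hypothesis
    -- leaves an unqueried live element to serve as witness at every query.
    close : ∀ f {K Σ} → Valid Σ → (∀ {i} → i ∈ K → i ∈ queried Σ) → length K + f ≤ suc depth →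
      length (queried Σ) + nodeBound width f < B → Extension Σ (nodeBound width f) (Closed f K)

    closeAll : ∀ f xs {K Σ} → Valid Σ → (∀ {i} → i ∈ K → i ∈ queried Σ) → length K + suc f ≤ suc depth →
      length (queried Σ) + length xs * suc (nodeBound width f) < B →
      Extension Σ (length xs * suc (nodeBound width f)) (λ Σ′ G → ∀ {x} → x ∈ xs → x ∈ G × Closed f (x ∷ K) Σ′ G)

    close zero {K} {Σ} valid K⊆ K≤ room = record
      { Σ′ = Σ ; valid′ = valid ; extends = ⊑-refl ; few = m≤m+n _ _
      ; G = [] ; G⊆ = λ () ; G-few = z≤n ; holds = tt }
    close (suc f) {K} {Σ} valid K⊆ K≤ room = record
      { Σ′ = Σ′ ; valid′ = valid′ ; extends = extends
      ; few = ≤-trans few (+-monoʳ-≤ (length (queried Σ)) bound)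
      ; G = G ; G⊆ = G⊆ ; G-few = ≤-trans G-few bound
      ; holds = λ x∈ → holds (subst (_ ∈_) (sym (children-cong extends K⊆)) x∈) }
      where
      bound : length (children K Σ) * suc (nodeBound width f) ≤ nodeBound width (suc f)
      bound = *-monoˡ-≤ (suc (nodeBound width f)) (length-children K Σ (m+n≤o⇒m≤o (length K) K≤))
      open Extension (closeAll f (children K Σ) valid K⊆ K≤
        (≤-<-trans (+-monoʳ-≤ (length (queried Σ)) bound) room))

    closeAll f [] {K} {Σ} valid K⊆ K≤ room = record
      { Σ′ = Σ ; valid′ = valid ; extends = ⊑-refl ; few = m≤m+n _ _
      ; G = [] ; G⊆ = λ () ; G-few = z≤n ; holds = λ () }
    closeAll f (x ∷ xs) {K} {Σ} valid K⊆ K≤ room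
      with b , w∉ ← fresh Fin._≟_ live live-injective (x ∷ queried Σ)
             (≤-<-trans (≤-trans (≤-reflexive (+-comm 1 (length (queried Σ)))) (+-monoʳ-≤ (length (queried Σ)) (s≤s z≤n))) room)
      with Σ₁ , valid₁ , ext₁ , x∈₁ , few₁ ← query Σ valid x (live b) (live-live b) w∉ = record
      { Σ′ = E₃.Σ′ ; valid′ = E₃.valid′
      ; extends = ⊑-trans ext₁ (⊑-trans E₂.extends E₃.extends)
      ; few = ≤-trans E₃.few (≤-trans (+-monoˡ-≤ r few₂) (≤-reflexive (+-assoc (length (queried Σ)) (suc N) r)))
      ; G = x ∷ E₂.G ++ E₃.G
      ; G⊆ = G⊆
      ; G-few = s≤s (≤-trans (≤-reflexive (length-++ E₂.G)) (+-mono-≤ E₂.G-few E₃.G-few))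
      ; holds = holds }
      where
      N = nodeBound width f
      r = length xs * suc N
      q = length (queried Σ)
      K⊆₁ : ∀ {i} → i ∈ x ∷ K → i ∈ queried Σ₁
      K⊆₁ (here refl) = x∈₁
      K⊆₁ (there i∈)  = queried-⊆ ext₁ (K⊆ i∈)
      room₁ : length (queried Σ₁) + N < B
      room₁ = ≤-<-trans (begin
        length (queried Σ₁) + N  ≤⟨ +-monoˡ-≤ N few₁ ⟩
        suc q + N                ≡⟨ sym (+-suc q N) ⟩
        q + suc N                ≤⟨ +-monoʳ-≤ q (m≤m+n (suc N) r) ⟩
        q + (suc N + r)          ∎) room
        where open ≤-Reasoning
      module E₂ = Extension (close f {x ∷ K} {Σ₁} valid₁ K⊆₁ (≤-trans (≤-reflexive (sym (+-suc (length K) f))) K≤) room₁)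
      few₂ : length (queried E₂.Σ′) ≤ q + suc N
      few₂ = ≤-trans E₂.few (≤-trans (+-monoˡ-≤ N few₁) (≤-reflexive (sym (+-suc q N))))
      module E₃ = Extension (closeAll f xs {K} {E₂.Σ′} E₂.valid′
        (queried-⊆ E₂.extends ∘ queried-⊆ ext₁ ∘ K⊆) K≤
        (≤-<-trans (≤-trans (+-monoˡ-≤ r few₂) (≤-reflexive (+-assoc q (suc N) r))) room))
      G⊆ : ∀ {i} → i ∈ x ∷ E₂.G ++ E₃.G → i ∈ queried E₃.Σ′
      G⊆ (here refl) = queried-⊆ E₃.extends (queried-⊆ E₂.extends x∈₁)
      G⊆ (there i∈) with ∈-++⁻ E₂.G i∈
      ... | inj₁ i∈₂ = queried-⊆ E₃.extends (E₂.G⊆ i∈₂)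
      ... | inj₂ i∈₃ = E₃.G⊆ i∈₃
      holds : ∀ {y} → y ∈ x ∷ xs → y ∈ x ∷ E₂.G ++ E₃.G × Closed f (y ∷ K) E₃.Σ′ (x ∷ E₂.G ++ E₃.G)
      holds (here refl) = here refl , closed-weaken f (there ∘ ∈-++⁺ˡ)
        (closed-extend f E₃.extends (queried-⊆ E₂.extends ∘ K⊆₁) E₂.G⊆ E₂.holds)
      holds (there y∈) with y∈G , c ← E₃.holds y∈ =
        there (∈-++⁺ʳ E₂.G y∈G) , closed-weaken f (there ∘ ∈-++⁺ʳ E₂.G) c

    -- If `F` is false, only `last` and the tree are kept. The tree is the same in the smaller state
    -- `Σ₀`, so `F` is decided there too. The size of `Σ₀` does not depend on how much had been
    -- queried before.
    settle-line : AllHit → ∀ {Σ} → Valid Σ → last ∈ queried Σ →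
      length (queried Σ) + nodeBound width depth < B →
      ∃[ Σ′ ] Valid Σ′ × Σ ⊑ Σ′ × length (queried Σ′) ≤ length (queried Σ) + nodeBound width depth ×
        (TrueDNF Σ′ F ⊎ ∃[ Σ₀ ] Valid Σ₀ × last ∈ queried Σ₀ ×
          length (queried Σ₀) ≤ suc (nodeBound width depth) × FalseDNF Σ₀ F)
    settle-line all-hit {Σ} valid last∈ room = E.Σ′ , E.valid′ , E.extends , E.few ,
      [ inj₁ , inj₂ ∘ shrink ]′ (decide all-hit (queried-⊆ E.extends last∈) E.G⊆ E.holds)
      where
      closure : Extension Σ (nodeBound width depth) (Closed depth [ last ])
      closure = close depth {[ last ]} {Σ} valid (λ { (here refl) → last∈ }) ≤-refl room
      module E = Extension closure
      Σ₀ : State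
      Σ₀ = state (last ∷ E.G) (position E.Σ′) (wit E.Σ′)
      Σ₀⊑Σ′ : Σ₀ ⊑ E.Σ′
      Σ₀⊑Σ′ = record
        { queried-⊆ = λ { (here refl) → queried-⊆ E.extends last∈ ; (there i∈) → E.G⊆ i∈ }
        ; position-same = λ _ → refl ; wit-same = λ _ → refl }
      shrink : FalseDNF E.Σ′ F → ∃[ Σ₀ ] Valid Σ₀ × last ∈ queried Σ₀ ×
               length (queried Σ₀) ≤ suc (nodeBound width depth) × FalseDNF Σ₀ F
      shrink false-in-Σ′ = Σ₀ ,
        (λ j∈ → let lw , lower = E.valid′ (queried-⊆ Σ₀⊑Σ′ j∈) in lw , lower ∘ queried-⊆ Σ₀⊑Σ′) ,
        here refl , s≤s E.G-few ,
        -- Truth in `Σ₀` would persist in the larger state, where `F` is false.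
        [ (λ t → contradiction false-in-Σ′ (dnf-exclusive {E.Σ′} (TrueDNF-mono Σ₀⊑Σ′ t))) , id ]′
          (decide all-hit {Σ₀} {E.G} (here refl) there
            (closed-restrict depth Σ₀⊑Σ′ (λ { (here refl) → here refl }) there E.holds))

-- The walk from the root to an axiom

∼-trans : {C D E : Conjunction V} → C ∼[ set ] D → D ∼[ set ] E → C ∼[ set ] E
∼-trans {V} {C} {D} {E} C∼D D∼E = Setoid.trans ([ set ]-Equality (Literal V)) {C} {D} {E} C∼D D∼E

-- Width is measured up to set equality; representatives with at most `d` listed literals make the
-- counting arguments apply to list lengths.
narrowed : ∀ {d} {P : DNF V} → IsDNF d P → ∃[ F ] All (λ C → length C ≤ d) F × F ≈ P
narrowed [] = [] , [] , id , id
narrowed {d = d} {P = C ∷ P} ((D , C∼D , D≤d) ∷ widths) with F , narrow , F⊆P , P⊆F ← narrowed widths =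
  D ∷ F , D≤d ∷ narrow , forth , back
  where
  forth : ∀ {E} → Any (E ∼[ set ]_) (D ∷ F) → Any (E ∼[ set ]_) (C ∷ P)
  forth {E} (here E∼D) = here (λ {ℓ} → ∼-trans {C = E} {D} {C} E∼D (∼-sym {C = C} {D} C∼D) {ℓ})
  forth {E} (there E∈) = there (F⊆P E∈)
  back : ∀ {E} → Any (E ∼[ set ]_) (C ∷ P) → Any (E ∼[ set ]_) (D ∷ F)
  back {E} (here E∼C) = here (λ {ℓ} → ∼-trans {C = E} {C} {D} E∼C C∼D {ℓ})
  back {E} (there E∈) = there (P⊆F E∈)

pointwise-length : ∀ {A : Set} {_∼_ : A → A → Set} {xs ys} → Pointwise _∼_ xs ys → length xs ≡ length ys
pointwise-length []       = refl
pointwise-length (_ ∷ es) = cong suc (pointwise-length es)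

two-premises : ∀ {d Ps} {P : DNF V} → Rule d Ps P → length Ps ≤ 2
two-premises (∧-introduction _ _ _ _ _) = ≤-refl
two-premises (cut _ _ _)                = ≤-refl
two-premises (weakening₁ _ _ _)         = s≤s z≤n
two-premises (weakening₂ _ _ _)         = s≤s z≤n

module Refute {d n : ℕ} (π : Refutation d (RLNP d n)) where

  open Refutation π

  narrowLine : ∀ k → ∃[ F ] All (λ C → length C ≤ d) F × F ≈ line k
  narrowLine k = narrowed (line-isDNF k)

  module _ (β : Var d n → Bool) (last : Fin n) (t : ℕ) where
    open Semantics {d} {n} β
    module LineSearch (k : Fin size) = Search β last t (proj₁ (narrowLine k)) (proj₁ (proj₂ (narrowLine k)))

    N : ℕ
    N = nodeBound (t * (d * 2) + suc (d * 2)) (d * 2)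

    module _ (last-live : ∀ i → suc (toℕ i) ≡ n → Live i)
             (all-witnessed : ∀ j → ∃[ i ] β (S i j) ≡ true)
             {B : ℕ} (live : Fin B → Fin n) (live-injective : ∀ {b c} → live b ≡ live c → b ≡ c)
             (live-live : ∀ b → Live (live b))
             (all-hit : ∀ k → LineSearch.AllHit k)
             -- A small state has at most `suc N` queried elements. Each of at most two premises
             -- costs a search tree (`N`) or the support of an axiom (at most 3), and every query
             -- needs a fresh witness among the `B` live elements.
             (room : suc N + 2 * (N + 3) < B) where

      False-in-small-state : Fin size → Set
      False-in-small-state k =
        ∃[ Σ ] Valid Σ × last ∈ queried Σ × length (queried Σ) ≤ suc N × FalseDNF Σ (line k)

      queryAll : ∀ xs Σ → Valid Σ → length (queried Σ) + length xs < B →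
        ∃[ Σ′ ] Valid Σ′ × Σ ⊑ Σ′ × length (queried Σ′) ≤ length (queried Σ) + length xs ×
          (∀ {i} → i ∈ xs → i ∈ queried Σ′)
      queryAll [] Σ valid few = Σ , valid , ⊑-refl , m≤m+n _ _ , λ ()
      queryAll (x ∷ xs) Σ valid few
        with b , w∉ ← fresh Fin._≟_ live live-injective (x ∷ queried Σ)
               (≤-<-trans (≤-trans (≤-reflexive (+-comm 1 (length (queried Σ)))) (+-monoʳ-≤ (length (queried Σ)) (s≤s z≤n))) few)
        with Σ₁ , valid₁ , ext₁ , x∈₁ , few₁ ← query Σ valid x (live b) (live-live b) w∉
        with step ← ≤-trans (+-monoˡ-≤ (length xs) few₁) (≤-reflexive (sym (+-suc (length (queried Σ)) (length xs))))
        with Σ₂ , valid₂ , ext₂ , few₂ , xs∈ ← queryAll xs Σ₁ valid₁ (≤-<-trans step few) =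
        Σ₂ , valid₂ , ⊑-trans ext₁ ext₂ , ≤-trans few₂ step ,
        λ { (here refl) → queried-⊆ ext₂ x∈₁ ; (there i∈) → xs∈ i∈ }

      True-extension : State → ℕ → (State → Set) → Set
      True-extension Σ k P = ∃[ Σ′ ] Valid Σ′ × Σ ⊑ Σ′ × length (queried Σ′) ≤ length (queried Σ) + k × P Σ′

      verify : ∀ ν → (∀ {j} → ν ≡ inj₂ j → ¬ False-in-small-state j) → ∀ {Σ} → Valid Σ → last ∈ queried Σ →
        length (queried Σ) + (N + 3) < B → True-extension Σ (N + 3) (λ Σ′ → TrueDNF Σ′ (label ν))
      verify (inj₁ (D , A)) hyp {Σ} valid last∈ room′
        with le ← +-monoʳ-≤ (length (queried Σ)) (≤-trans (support≤3 A) (m≤n+m 3 N))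
        with Σ′ , valid′ , ext , few , known ← queryAll (support A) Σ valid (≤-<-trans le room′) =
        Σ′ , valid′ , ext , ≤-trans few le , axiom-true last-live all-witnessed {Σ′} A valid′ known
      verify (inj₂ k) hyp {Σ} valid last∈ room′
        with le ← +-monoʳ-≤ (length (queried Σ)) (m≤m+n N 3)
        with LineSearch.settle-line k live live-injective live-live (all-hit k) valid last∈ (≤-<-trans le room′)
      ... | Σ′ , valid′ , ext , few , inj₁ t =
        Σ′ , valid′ , ext , ≤-trans few le , TrueDNF-resp {Σ′} (proj₂ (proj₂ (narrowLine k))) t
      ... | Σ′ , valid′ , ext , few , inj₂ (Σ₀ , valid₀ , last∈₀ , small , f) =
        ⊥-elim (hyp refl (Σ₀ , valid₀ , last∈₀ , small , FalseDNF-resp {Σ₀} (proj₂ (proj₂ (narrowLine k))) f))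

      verifyAll : ∀ νs → (∀ {j} → inj₂ j ∈ νs → ¬ False-in-small-state j) → ∀ {Σ} → Valid Σ → last ∈ queried Σ →
        length (queried Σ) + length νs * (N + 3) < B →
        True-extension Σ (length νs * (N + 3)) (λ Σ′ → All (TrueDNF Σ′) (map label νs))
      verifyAll [] hyp {Σ} valid last∈ room′ = Σ , valid , ⊑-refl , m≤m+n _ _ , []
      verifyAll (ν ∷ νs) hyp {Σ} valid last∈ room′
        with Σ₁ , valid₁ , ext₁ , few₁ , t₁ ← verify ν (λ { refl → hyp (here refl) }) valid last∈
               (≤-<-trans (+-monoʳ-≤ (length (queried Σ)) (m≤m+n (N + 3) (length νs * (N + 3)))) room′)
        with le ← ≤-trans (+-monoˡ-≤ (length νs * (N + 3)) few₁)
                          (≤-reflexive (+-assoc (length (queried Σ)) (N + 3) (length νs * (N + 3))))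
        with Σ₂ , valid₂ , ext₂ , few₂ , ts ← verifyAll νs (hyp ∘ there) valid₁ (queried-⊆ ext₁ last∈) (≤-<-trans le room′) =
        Σ₂ , valid₂ , ⊑-trans ext₁ ext₂ , ≤-trans few₂ le , TrueDNF-mono ext₂ t₁ ∷ ts

      -- The walk read as an induction: by the induction hypothesis no premise is false in a small
      -- state, so the premises can be made true one after the other while line `k` stays false,
      -- against soundness.
      never-false : ∀ k → Acc Fin._<_ k → ¬ False-in-small-state k
      never-false k (acc rec) (Σ , valid , last∈ , small , f)
        with Ps , P , rule , Ps≈ , P≈ ← inference k
        with premises≤2 ← ≤-trans (≤-reflexive (trans (sym (length-map label (premises k))) (pointwise-length Ps≈)))
                                  (two-premises rule)
        with Σ′ , valid′ , ext , _ , ts ← verifyAll (premises k) (λ j∈ → never-false _ (rec (ordered j∈))) valid last∈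
               (≤-<-trans (+-mono-≤ small (*-monoˡ-≤ (N + 3) premises≤2)) room) =
        inference-sound {Σ′} (Ps , P , rule , Ps≈ , P≈) ts (FalseDNF-mono ext f)

      no-refutation : ⊥
      no-refutation
        with b , w∉ ← fresh Fin._≟_ live live-injective (last ∷ []) (≤-<-trans (≤-trans (m≤m+n 1 N) (m≤m+n (suc N) (2 * (N + 3)))) room)
        with Σ′ , _ , _ , _ , t ← verify root (λ { refl → never-false _ (Fin.<-wellFounded _) })
               -- Only `last` is queried, and `live b` differs from it, so the initial witness is an
               -- unqueried promise.
               {state (last ∷ []) (λ _ → 0) (λ _ → live b)}
               (λ _ → live-live b , λ w∈ → contradiction w∈ w∉) (here refl)
               (≤-<-trans (+-mono-≤ (m≤m+n 1 N) (m≤m+n (N + 3) _)) room)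
        with () ← subst (TrueDNF Σ′) root-empty t

-- The choice of the restriction

length-sublists : ∀ {A : Set} (xs : List A) → length (sublists xs) ≡ 2 ^ length xs
length-sublists []       = refl
length-sublists (x ∷ xs) = begin
  length (map (x ∷_) (sublists xs) ++ sublists xs)       ≡⟨ length-++ (map (x ∷_) (sublists xs)) ⟩
  length (map (x ∷_) (sublists xs)) + length (sublists xs)
    ≡⟨ cong₂ _+_ (trans (length-map (x ∷_) (sublists xs)) (length-sublists xs)) (trans (length-sublists xs) (sym (+-identityʳ _))) ⟩
  2 ^ suc (length xs) ∎
  where open ≡-Reasoning

length-allFin : ∀ n → length (allFin n) ≡ n
length-allFin n = length-tabulate id

shortLists : ∀ {n} → ℕ → List (List (Fin n))
shortLists         zero    = [ [] ]
shortLists {n} (suc m) = [] ∷ concatMap (λ i → map (i ∷_) (shortLists m)) (allFin n)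

length-shortLists : ∀ {n} m → length (shortLists {n} m) ≤ suc n ^ m
length-shortLists     zero    = ≤-refl
length-shortLists {n} (suc m) = begin
  suc (length (concatMap (λ i → map (i ∷_) (shortLists m)) (allFin n)))
    ≤⟨ +-mono-≤ (m^n>0 (suc n) m) (length-concatMap≤ (λ i → map (i ∷_) (shortLists m)) (suc n ^ m) (allFin n)
         λ {i} _ → ≤-trans (≤-reflexive (length-map (i ∷_) (shortLists m))) (length-shortLists m)) ⟩
  suc n ^ m + length (allFin n) * suc n ^ m  ≡⟨ cong (λ k → suc n ^ m + k * suc n ^ m) (length-allFin n) ⟩
  suc n ^ suc m                              ∎
  where open ≤-Reasoning

∈-shortLists⁺ : ∀ {n} m {K : List (Fin n)} → length K ≤ m → K ∈ shortLists m
∈-shortLists⁺ zero    {[]}    _        = here refl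
∈-shortLists⁺ (suc m) {[]}    _        = here refl
∈-shortLists⁺ (suc m) {i ∷ K} (s≤s K≤) =
  there (∈-concatMap⁺ (λ i → map (i ∷_) (shortLists m)) (lose (∈-allFin i) (∈-map⁺ (i ∷_) (∈-shortLists⁺ m K≤))))

∈-shortLists⁻ : ∀ {n} m {K : List (Fin n)} → K ∈ shortLists m → length K ≤ m
∈-shortLists⁻ zero    (here refl) = z≤n
∈-shortLists⁻ (suc m) (here refl) = z≤n
∈-shortLists⁻ {n} (suc m) (there K∈)
  with i , _ , K∈i ← find (∈-concatMap⁻ (λ i → map (i ∷_) (shortLists m)) {xs = allFin n} K∈)
  with _ , K′∈ , refl ← ∈-map⁻ (i ∷_) K∈i = s≤s (∈-shortLists⁻ m K′∈)

allPairs-allFin : ∀ {A : Set} {_~_ : A → A → Set} n (f : Fin n → A) →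
  (∀ {i j} → i ≢ j → f i ~ f j) → AllPairs _~_ (map f (allFin n))
allPairs-allFin n f distinct = AllPairs.map⁺ (AllPairs.tabulate⁺ distinct)

module Restriction {d m : ℕ} (π : Refutation d (RLNP d (suc m))) (t B : ℕ) (1≤d : 1 ≤ d)
                   (t≤n : t ≤ suc m) (Bt≤n : B * t ≤ suc m) where

  n w depth : ℕ
  n     = suc m
  w     = d + d * 2 * d
  depth = d * 2

  last : Fin n
  last = fromℕ m

  open Refutation π
  open Refute π using (narrowLine)
  open Combinatorics {d} {n}

  module LineGreedy (k : Fin size) = Greedy (proj₁ (narrowLine k)) (proj₁ (proj₂ (narrowLine k)))

  Demands : Set
  Demands = List (List (Literal (Var d n)))

  lineTest : ∀ k K T → LineGreedy.Heavy k K T t [] ⊎ LineGreedy.Light k K T t [] (proj₁ (narrowLine k)) → List Demands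
  lineTest k K T (inj₁ h) = [ map (demand K) (LineGreedy.Heavy.terms h) ]
  lineTest k K T (inj₂ _) = []

  -- The families must be the very ones that the search will find, hence the same call of `greedy`
  -- as in `outcome`.
  greedyTest : Fin size → Elements → List (Var d n) → List Demands
  greedyTest k K T = lineTest k K T (LineGreedy.greedy k K T t [] (proj₁ (narrowLine k)) id)

  lineTest-valid : ∀ k K T o {τ} → τ ∈ lineTest k K T o → Test w t τ
  lineTest-valid k K T (inj₁ h) (here refl) = LineGreedy.heavy-test k K T h

  lineTestsAt : Fin size → Elements → List Demands
  lineTestsAt k K = concatMap (greedyTest k K) (sublists (insideVars K))

  lineTestsOf : Fin size → List Demands
  lineTestsOf k = concatMap (lineTestsAt k) (shortLists (suc depth))

  lineTests : List Demands
  lineTests = concatMap lineTestsOf (allFin size)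

  element : Fin B → Fin t → Fin n
  element b q = inject≤ (combine b q) Bt≤n

  element-injective : ∀ b q c r → element b q ≡ element c r → b ≡ c × q ≡ r
  element-injective b q c r eq = Fin.combine-injective b q c r (Fin.inject≤-injective Bt≤n Bt≤n _ _ eq)

  relativize : Fin n → List (Literal (Var d n))
  relativize i = map (λ p → pos (R p i)) (allFin d)

  -- Hitting it makes some element of block `b` live; as the blocks are disjoint, this provides `B`
  -- distinct live elements.
  liveTest : Fin B → Demands
  liveTest b = map (λ q → relativize (element b q)) (allFin t)

  -- Hitting it satisfies the axiom `witness j` in case `j` is dead.
  witnessTest : Fin n → Demands
  witnessTest j = map (λ q → [ pos (S (inject≤ q t≤n) j) ]) (allFin t)

  tests : List Demands
  tests = lineTests ++ map liveTest (allFin B) ++ map witnessTest (allFin n)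

  insideBound : ℕ
  insideBound = suc depth * d + (suc depth * suc depth + suc depth * suc depth)

  length-lineTests : length lineTests ≤ size * (suc n ^ suc depth * 2 ^ insideBound)
  length-lineTests = ≤-trans
    (length-concatMap≤ lineTestsOf (suc n ^ suc depth * 2 ^ insideBound) (allFin size) λ {k} _ → per-line k)
    (≤-reflexive (cong (_* (suc n ^ suc depth * 2 ^ insideBound)) (length-allFin size)))
    where
    one : ∀ k K T o → length (lineTest k K T o) ≤ 1
    one k K T (inj₁ _) = ≤-refl
    one k K T (inj₂ _) = z≤n
    per-node : ∀ k {K} → length K ≤ suc depth → length (lineTestsAt k K) ≤ 2 ^ insideBound
    per-node k {K} K≤ = begin
      length (lineTestsAt k K)            ≤⟨ length-concatMap≤ (greedyTest k K) 1 (sublists (insideVars K)) (λ {T} _ → one k K T (LineGreedy.greedy k K T t [] (proj₁ (narrowLine k)) id)) ⟩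
      length (sublists (insideVars K)) * 1 ≡⟨ *-identityʳ _ ⟩
      length (sublists (insideVars K))     ≡⟨ length-sublists (insideVars K) ⟩
      2 ^ length (insideVars K)            ≤⟨ ^-monoʳ-≤ 2 (≤-trans (length-insideVars K)
        (+-mono-≤ (*-monoˡ-≤ d K≤) (+-mono-≤ (*-mono-≤ K≤ K≤) (*-mono-≤ K≤ K≤)))) ⟩
      2 ^ insideBound                      ∎
      where open ≤-Reasoning
    per-line : ∀ k → length (lineTestsOf k) ≤ suc n ^ suc depth * 2 ^ insideBound
    per-line k = ≤-trans
      (length-concatMap≤ (lineTestsAt k) (2 ^ insideBound) (shortLists (suc depth)) λ {K} K∈ → per-node k {K} (∈-shortLists⁻ (suc depth) K∈))
      (*-monoˡ-≤ (2 ^ insideBound) (length-shortLists (suc depth)))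

  length-tests : length tests ≤ size * (suc n ^ suc depth * 2 ^ insideBound) + (B + n)
  length-tests = begin
    length tests
      ≡⟨ length-++ lineTests ⟩
    length lineTests + length (map liveTest (allFin B) ++ map witnessTest (allFin n))
      ≡⟨ cong (length lineTests +_) (length-++ (map liveTest (allFin B))) ⟩
    length lineTests + (length (map liveTest (allFin B)) + length (map witnessTest (allFin n)))
      ≡⟨ cong (length lineTests +_) (cong₂ _+_ (trans (length-map liveTest (allFin B)) (length-allFin B))
                                              (trans (length-map witnessTest (allFin n)) (length-allFin n))) ⟩
    length lineTests + (B + n)
      ≤⟨ +-monoˡ-≤ (B + n) length-lineTests ⟩
    size * (suc n ^ suc depth * 2 ^ insideBound) + (B + n) ∎
    where open ≤-Reasoning

  ∈-lineTests : ∀ k K T → length K ≤ suc depth → T ∈ sublists (insideVars K) →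
    ∀ h → LineGreedy.greedy k K T t [] (proj₁ (narrowLine k)) id ≡ inj₁ h → map (demand K) (LineGreedy.Heavy.terms h) ∈ tests
  ∈-lineTests k K T K≤ T∈ h eq = ∈-++⁺ˡ (∈-concatMap⁺ lineTestsOf (lose (∈-allFin k)
    (∈-concatMap⁺ (lineTestsAt k) (lose {x = K} (∈-shortLists⁺ (suc depth) K≤)
      (∈-concatMap⁺ (greedyTest k K) (lose T∈
        (subst (λ o → _ ∈ lineTest k K T o) (sym eq) (here refl))))))))

  tests-valid : All (Test w t) tests
  tests-valid = All.++⁺ (All.tabulate line-valid)
    (All.++⁺ (All.map⁺ (All.universal live-valid (allFin B))) (All.map⁺ (All.universal witness-valid (allFin n))))
    where
    line-valid : ∀ {τ} → τ ∈ lineTests → Test w t τ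
    line-valid τ∈
      with k , _ , τ∈k ← find (∈-concatMap⁻ lineTestsOf {xs = allFin size} τ∈)
      with K , _ , τ∈K ← find (∈-concatMap⁻ (lineTestsAt k) {xs = shortLists (suc depth)} τ∈k)
      with T , _ , τ∈T ← find (∈-concatMap⁻ (greedyTest k K) {xs = sublists (insideVars K)} τ∈K) =
      lineTest-valid k K T _ τ∈T
    live-valid : ∀ b → Test w t (liveTest b)
    live-valid b = record
      { number     = trans (length-map (λ q → relativize (element b q)) (allFin t)) (length-allFin t)
      ; widths     = All.map⁺ (All.universal (λ q → ≤-trans
                       (≤-reflexive (trans (length-map (λ p → pos (R p (element b q))) (allFin d)) (length-allFin d))) (m≤m+n d _)) (allFin t))
      ; consistent = All.map⁺ (All.universal (λ q → λ {ℓ} → positive q {ℓ}) (allFin t))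
      ; disjoint   = allPairs-allFin t (λ q → relativize (element b q)) (λ {q} {r} q≢r {v} → disjoint q r q≢r {v}) }
      where
      positive : ∀ q → Consistent (relativize (element b q))
      positive q ℓ∈ ¬ℓ∈ with _ , _ , refl ← ∈-map⁻ _ ℓ∈ with _ , _ , () ← ∈-map⁻ _ ¬ℓ∈
      about : ∀ q {v} → v ∈ map var (relativize (element b q)) → ∃[ p ] v ≡ R p (element b q)
      about q v∈ with ℓ , ℓ∈ , refl ← ∈-map⁻ var v∈ with p , _ , refl ← ∈-map⁻ (λ p → pos (R p (element b q))) ℓ∈ = p , refl
      disjoint : ∀ q r → q ≢ r → DisjointVars (relativize (element b q)) (relativize (element b r))
      disjoint q r q≢r {v} v∈ v∈′ with p , eq ← about q v∈ with p′ , eq′ ← about r v∈′ =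
        q≢r (proj₂ (element-injective b q b r (same (trans (sym eq) eq′))))
        where
        same : ∀ {p p′ : Fin d} {i j : Fin n} → R p i ≡ R p′ j → i ≡ j
        same refl = refl
    witness-valid : ∀ j → Test w t (witnessTest j)
    witness-valid j = record
      { number     = trans (length-map (λ q → [ pos (S (inject≤ q t≤n) j) ]) (allFin t)) (length-allFin t)
      ; widths     = All.map⁺ (All.universal (λ q → ≤-trans 1≤d (m≤m+n d _)) (allFin t))
      ; consistent = All.map⁺ (All.universal (λ q → λ { (here refl) (here ()) }) (allFin t))
      ; disjoint   = allPairs-allFin t (λ q → [ pos (S (inject≤ q t≤n) j) ]) λ { q≢r (here refl) (here eq) → q≢r (same eq) } }
      where
      same : ∀ {q r} → S {d} {n} (inject≤ q t≤n) j ≡ S (inject≤ r t≤n) j → q ≡ r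
      same {q} {r} eq = Fin.inject≤-injective t≤n t≤n q r (first eq)
        where
        first : ∀ {i i′ j j′ : Fin n} → S {d} i j ≡ S i′ j′ → i ≡ i′
        first refl = refl

  -- `last` must be live whatever `α` says. No relevant hit is lost: `liveTest` asks for positive
  -- `R` literals, `witnessTest` for no `R` at all, and line tests at nodes containing `last` never
  -- mention `R p last`.
  restrict : (Var d n → Bool) → Var d n → Bool
  restrict α (L i j) = α (L i j)
  restrict α (S i j) = α (S i j)
  restrict α (R p i) = if does (i Fin.≟ last) then true else α (R p i)

  restrict-R : ∀ α {p i} → α (R p i) ≡ true → restrict α (R p i) ≡ true
  restrict-R α {p} {i} eq with i Fin.≟ last
  ... | yes _ = refl
  ... | no  _ = eq

  restrict-other : ∀ α v {i} → i ∈ elements v → i ≢ last → restrict α v ≡ α v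
  restrict-other α (L i j) _ _ = refl
  restrict-other α (S i j) _ _ = refl
  restrict-other α (R p i) (here refl) i≢ rewrite dec-false (i Fin.≟ last) i≢ = refl

  N : ℕ
  N = nodeBound (t * depth + suc depth) depth

  module _ (room : suc N + 2 * (N + 3) < B) where

    unhittable : ∀ α → ¬ (∀ {τ} → τ ∈ tests → Hits α τ)
    unhittable α hits =
      Refute.no-refutation π β last t last-live all-witnessed live live-injective live-live all-hit room
      where
      β = restrict α
      open Semantics {d} {n} β using (Live)
      last-live : ∀ i → suc (toℕ i) ≡ n → Live i
      last-live i eq p rewrite dec-true (i Fin.≟ last)
        (Fin.toℕ-injective (trans (suc-injective eq) (sym (Fin.toℕ-fromℕ m)))) = refl
      all-witnessed : ∀ j → ∃[ i ] β (S i j) ≡ true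
      all-witnessed j with q , _ , s ∷ [] ← find (Any.map⁻ (hits
        (∈-++⁺ʳ lineTests (∈-++⁺ʳ (map liveTest (allFin B)) (∈-map⁺ witnessTest (∈-allFin j)))))) =
        inject≤ q t≤n , s
      choice : ∀ b → ∃[ q ] Live (element b q)
      choice b with q , _ , sat ← find (Any.map⁻ (hits
        (∈-++⁺ʳ lineTests (∈-++⁺ˡ (∈-map⁺ liveTest (∈-allFin b)))))) =
        q , λ p → restrict-R α (All.lookup sat (∈-map⁺ (λ p → pos (R p (element b q))) (∈-allFin p)))
      live : Fin B → Fin n
      live b = element b (proj₁ (choice b))
      live-injective : ∀ {b c} → live b ≡ live c → b ≡ c
      live-injective {b} {c} eq = proj₁ (element-injective b _ c _ eq)
      live-live : ∀ b → Live (live b)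
      live-live b = proj₂ (choice b)
      all-hit : ∀ k → Search.AllHit β last t (proj₁ (narrowLine k)) (proj₁ (proj₂ (narrowLine k)))
      all-hit k K T K≤ T∈ last∈K h eq = Any.map⁺ (Any.map (λ {C} → transfer C) (Any.map⁻ (hits (∈-lineTests k K T K≤ T∈ h eq))))
        where
        transfer : ∀ C → All (Satisfies α) (demand K C) → All (Satisfies β) (demand K C)
        transfer C sat = All.tabulate λ {ℓ} ℓ∈ →
          let (i , i∈ , i∉K) , _ = demand-outside {K} {C} (∈-map⁺ var ℓ∈)
          in Semantics.satisfies-cong {d} {n} β {α} {β} ℓ (restrict-other α (var ℓ) i∈ λ i≡last → i∉K (subst (_∈ K) (sym i≡last) last∈K)) (All.lookup sat ℓ∈)

    too-small : ¬ (length tests * (2 ^ w ∸ 1) ^ t < (2 ^ w) ^ t)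
    too-small few = let α , hits = Hitting.hitting _≟ᵛ_ w tests tests-valid few in unhittable α hits

-- Choice of parameters

open ≤-Reasoning

^-*-mono : ∀ a b k → (a * b) ^ k ≡ a ^ k * b ^ k
^-*-mono a b zero    = refl
^-*-mono a b (suc k) = trans (cong (a * b *_) (^-*-mono a b k))
  (solve 4 (λ a b p q → a :* b :* (p :* q) := a :* p :* (b :* q)) refl a b (a ^ k) (b ^ k))
  where open +-*-Solver

suc≤2^ : ∀ x → suc x ≤ 2 ^ x
suc≤2^ zero    = ≤-refl
suc≤2^ (suc x) = begin
  suc (suc x)         ≤⟨ s≤s (suc≤2^ x) ⟩
  1 + 2 ^ x           ≤⟨ +-monoˡ-≤ (2 ^ x) (m^n>0 2 x) ⟩
  2 ^ x + 2 ^ x       ≡⟨ cong (2 ^ x +_) (sym (+-identityʳ (2 ^ x))) ⟩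
  2 ^ suc x           ∎

-- Bernoulli's inequality (1 + 1/m)^k ≥ 1 + k/m, multiplied by m^(k+1).
bernoulli : ∀ m k → m ^ k * (m + k) ≤ m * suc m ^ k
bernoulli m zero    = ≤-reflexive (trans (+-identityʳ (m + 0)) (trans (+-identityʳ m) (sym (*-identityʳ m))))
bernoulli m (suc k) = begin
  m * m ^ k * (m + suc k)
    ≤⟨ m≤m+n (m * m ^ k * (m + suc k)) (m ^ k * k) ⟩
  m * m ^ k * (m + suc k) + m ^ k * k
    ≡⟨ solve 3 (λ m k p → m :* p :* (m :+ (con 1 :+ k)) :+ p :* k := (con 1 :+ m) :* (p :* (m :+ k))) refl m k (m ^ k) ⟩
  suc m * (m ^ k * (m + k))
    ≤⟨ *-monoʳ-≤ (suc m) (bernoulli m k) ⟩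
  suc m * (m * suc m ^ k)
    ≡⟨ solve 3 (λ s m p → s :* (m :* p) := m :* (s :* p)) refl (suc m) m (suc m ^ k) ⟩
  m * suc m ^ suc k ∎
  where open +-*-Solver

-- Bernoulli with `k = m`. For `M = suc m` this says `(1 - 1 / M) ^ M ≤ 1 / 2`.
doubling : ∀ m → 2 * m ^ suc m ≤ suc m ^ suc m
doubling m = begin
  2 * m ^ suc m              ≡⟨ solve 2 (λ m p → con 2 :* (m :* p) := p :* (m :+ m)) refl m (m ^ m) ⟩
  m ^ m * (m + m)            ≤⟨ bernoulli m m ⟩
  m * suc m ^ m              ≤⟨ *-monoˡ-≤ (suc m ^ m) (n≤1+n m) ⟩
  suc m ^ suc m              ∎
  where open +-*-Solver

-- A test with `M * u` members, each true with probability at least `1 / M`, is missed with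
-- probability at most `1 / 2 ^ u`; this is the union bound for fewer than `2 ^ u` tests.
power-gap : ∀ M u c → 2 ≤ M → c < 2 ^ u → c * (M ∸ 1) ^ (M * u) < M ^ (M * u)
power-gap (suc (suc m)) u c (s≤s (s≤s _)) c<2^u = begin-strict
  c * suc m ^ (M * u)        <⟨ *-monoˡ-< (suc m ^ (M * u)) {{>-nonZero (m^n>0 (suc m) (M * u))}} c<2^u ⟩
  2 ^ u * suc m ^ (M * u)    ≡⟨ cong (2 ^ u *_) (sym (^-*-assoc (suc m) M u)) ⟩
  2 ^ u * (suc m ^ M) ^ u    ≡⟨ sym (^-*-mono 2 (suc m ^ M) u) ⟩
  (2 * suc m ^ M) ^ u        ≤⟨ ^-monoˡ-≤ u (doubling (suc m)) ⟩
  (M ^ M) ^ u                ≡⟨ ^-*-assoc M M u ⟩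
  M ^ (M * u)                ∎
  where M = suc (suc m)

nodeBound≤ : ∀ m f → suc (nodeBound m f) ≤ suc m ^ f
nodeBound≤ m zero    = ≤-refl
nodeBound≤ m (suc f) = begin
  suc (m * suc (nodeBound m f))                 ≤⟨ +-monoˡ-≤ (m * suc (nodeBound m f)) (s≤s z≤n) ⟩
  suc m * suc (nodeBound m f)                   ≤⟨ *-monoʳ-≤ (suc m) (nodeBound≤ m f) ⟩
  suc m ^ suc f                                 ∎

floor-root : ∀ b n → ∃[ x ] x ^ suc b ≤ n × n < suc x ^ suc b
floor-root b zero    = 0 , z≤n , m^n>0 1 (suc b)
floor-root b (suc n) with x , lo , hi ← floor-root b n with suc n <? suc x ^ suc b
... | yes hi′ = x , m≤n⇒m≤1+n lo , hi′
... | no ¬hi  = suc x , ≮⇒≥ ¬hi , ≤-<-trans hi (^-monoˡ-< (suc b) ≤-refl)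

-- In powers of `2 ^ x`, the factor `s` costs 1, `suc n ^ e` costs `b * e` and `2 ^ a` at most `a`;
-- the rest of the constant 4 absorbs the summand `B + n` and strictness.
tests-few : ∀ x b e a s n B → 1 ≤ x → 1 ≤ e → s ≤ 2 ^ x → suc n ≤ 2 ^ (x * b) → B ≤ n →
  s * (suc n ^ e * 2 ^ a) + (B + n) < 2 ^ ((b * e + a + 4) * x)
tests-few x b e a s n B 1≤x 1≤e s≤ n≤ B≤n = begin-strict
  s * (suc n ^ e * 2 ^ a) + (B + n)          ≤⟨ +-mono-≤ lines rest ⟩
  2 ^ E + 2 ^ E                              ≡⟨ cong (2 ^ E +_) (sym (+-identityʳ (2 ^ E))) ⟩
  2 ^ suc E                                  <⟨ ^-monoʳ-< 2 (s≤s (s≤s z≤n)) (≤-refl {suc (suc E)}) ⟩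
  2 ^ (2 + E)                                ≤⟨ ^-monoʳ-≤ 2 (begin
    2 + E                                      ≤⟨ +-monoˡ-≤ E (*-monoʳ-≤ 2 1≤x) ⟩
    2 * x + E                                  ≡⟨ solve 4 (λ x b e a → con 2 :* x :+ (b :* e :+ a :+ con 2) :* x
                                                     := (b :* e :+ a :+ con 4) :* x) refl x b e a ⟩
    (b * e + a + 4) * x                        ∎) ⟩
  2 ^ ((b * e + a + 4) * x)                  ∎
  where
  open +-*-Solver
  E = (b * e + a + 2) * x
  instance _ = >-nonZero 1≤x
  instance _ = >-nonZero 1≤e
  lines : s * (suc n ^ e * 2 ^ a) ≤ 2 ^ E
  lines = begin
    s * (suc n ^ e * 2 ^ a)             ≤⟨ *-mono-≤ s≤ (*-monoˡ-≤ (2 ^ a) (^-monoˡ-≤ e n≤)) ⟩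
    2 ^ x * ((2 ^ (x * b)) ^ e * 2 ^ a) ≡⟨ cong (λ p → 2 ^ x * (p * 2 ^ a)) (^-*-assoc 2 (x * b) e) ⟩
    2 ^ x * (2 ^ (x * b * e) * 2 ^ a)   ≡⟨ cong (2 ^ x *_) (sym (^-distribˡ-+-* 2 (x * b * e) a)) ⟩
    2 ^ x * 2 ^ (x * b * e + a)         ≡⟨ sym (^-distribˡ-+-* 2 x (x * b * e + a)) ⟩
    2 ^ (x + (x * b * e + a))           ≤⟨ ^-monoʳ-≤ 2 (begin
      x + (x * b * e + a)                 ≤⟨ +-monoʳ-≤ x (+-monoʳ-≤ (x * b * e) (m≤m*n a x)) ⟩
      x + (x * b * e + a * x)             ≤⟨ m≤m+n _ x ⟩
      x + (x * b * e + a * x) + x         ≡⟨ solve 4 (λ x b e a → x :+ (x :* b :* e :+ a :* x) :+ x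
                                                := (b :* e :+ a :+ con 2) :* x) refl x b e a ⟩
      E                                   ∎) ⟩
    2 ^ E                               ∎
  rest : B + n ≤ 2 ^ E
  rest = begin
    B + n                        ≤⟨ +-mono-≤ (≤-trans B≤n (≤-trans (n≤1+n n) n≤)) (≤-trans (n≤1+n n) n≤) ⟩
    2 ^ (x * b) + 2 ^ (x * b)    ≡⟨ cong (2 ^ (x * b) +_) (sym (+-identityʳ (2 ^ (x * b)))) ⟩
    2 ^ suc (x * b)              ≤⟨ ^-monoʳ-≤ 2 (begin
      suc (x * b)                  ≤⟨ +-mono-≤ 1≤x (m≤m*n (x * b) e) ⟩
      x + x * b * e                ≤⟨ m≤m+n _ (a * x + x) ⟩
      x + x * b * e + (a * x + x)  ≡⟨ solve 4 (λ x b e a → x :+ x :* b :* e :+ (a :* x :+ x)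
                                         := (b :* e :+ a :+ con 2) :* x) refl x b e a ⟩
      E                            ∎) ⟩
    2 ^ E                        ∎

-- The walk needs a live element in each of that many disjoint blocks of size t.
blocks-fit : ∀ M C D x → 1 ≤ x →
  let t = M * (C * x) ; N = nodeBound (t * D + suc D) D ; c = M * C * suc D + suc (suc D) in
  10 * c ^ suc D ≤ x → suc (suc N + 2 * (N + 3)) * t ≤ x ^ suc (suc D)
blocks-fit M C D x 1≤x large = begin
  suc (suc N + 2 * (N + 3)) * t   ≤⟨ *-monoˡ-≤ t (begin
    suc (suc N + 2 * (N + 3))       ≤⟨ m≤m+n _ (7 * N + 2) ⟩
    suc (suc N + 2 * (N + 3)) + (7 * N + 2)
      ≡⟨ solve 1 (λ N → con 1 :+ (con 1 :+ N :+ con 2 :* (N :+ con 3)) :+ (con 7 :* N :+ con 2)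
                     := con 10 :* (con 1 :+ N)) refl N ⟩
    10 * suc N                      ∎) ⟩
  10 * suc N * t                  ≤⟨ *-mono-≤ (*-monoʳ-≤ 10 N≤) t≤ ⟩
  10 * (c * x) ^ D * (c * x)      ≡⟨ trans (*-assoc 10 ((c * x) ^ D) (c * x)) (cong (10 *_) (*-comm ((c * x) ^ D) (c * x))) ⟩
  10 * (c * x) ^ suc D            ≡⟨ cong (10 *_) (^-*-mono c x (suc D)) ⟩
  10 * (c ^ suc D * x ^ suc D)    ≡⟨ sym (*-assoc 10 (c ^ suc D) (x ^ suc D)) ⟩
  10 * c ^ suc D * x ^ suc D      ≤⟨ *-monoˡ-≤ (x ^ suc D) large ⟩
  x ^ suc (suc D)                 ∎
  where
  open +-*-Solver
  instance _ = >-nonZero 1≤x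
  t = M * (C * x)
  N = nodeBound (t * D + suc D) D
  c = M * C * suc D + suc (suc D)
  width≤ : suc (t * D + suc D) ≤ c * x
  width≤ = begin
    suc (t * D + suc D)                          ≡⟨ sym (+-suc (t * D) (suc D)) ⟩
    t * D + suc (suc D)                          ≤⟨ +-mono-≤ (*-monoʳ-≤ t (n≤1+n D)) (m≤m*n (suc (suc D)) x) ⟩
    t * suc D + suc (suc D) * x                  ≡⟨ solve 5 (λ M C x s r → M :* (C :* x) :* s :+ r :* x
                                                      := (M :* C :* s :+ r) :* x) refl M C x (suc D) (suc (suc D)) ⟩
    c * x                                        ∎
  N≤ : suc N ≤ (c * x) ^ D
  N≤ = ≤-trans (nodeBound≤ (t * D + suc D) D) (^-monoˡ-≤ D width≤)
  t≤ : t ≤ c * x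
  t≤ = begin
    M * (C * x)        ≡⟨ sym (*-assoc M C x) ⟩
    M * C * x          ≤⟨ *-monoˡ-≤ x (≤-trans (m≤m*n (M * C) (suc D)) (m≤m+n _ (suc (suc D)))) ⟩
    c * x              ∎

-- x is n^(1/b) rounded down and hence at least half of it.
exponent-bound : ∀ b x n k m .{{_ : NonZero m}} → 1 ≤ x → n < suc x ^ suc b →
                 (2 * k) ^ suc b ≤ (1 * m) ^ suc b * n ^ 1 → k ≤ x * m
exponent-bound b x n k m 1≤x n< h = *-cancelˡ-≤ 2 (begin
  2 * k              ≤⟨ <⇒≤ 2k< ⟩
  m * suc x          ≤⟨ *-monoʳ-≤ m (+-monoˡ-≤ x 1≤x) ⟩
  m * (x + x)        ≡⟨ solve 2 (λ m x → m :* (x :+ x) := con 2 :* (x :* m)) refl m x ⟩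
  2 * (x * m)        ∎)
  where
  open +-*-Solver
  2k< : 2 * k < m * suc x
  2k< = ≰⇒> λ m*sx≤2k → <⇒≱ (begin-strict
    (2 * k) ^ suc b                ≤⟨ h ⟩
    (1 * m) ^ suc b * n ^ 1        ≡⟨ cong₂ (λ p q → p ^ suc b * q) (*-identityˡ m) (*-identityʳ n) ⟩
    m ^ suc b * n                  <⟨ *-monoʳ-< (m ^ suc b) {{m^n≢0 m (suc b)}} n< ⟩
    m ^ suc b * suc x ^ suc b      ≡⟨ sym (^-*-mono m (suc x) (suc b)) ⟩
    (m * suc x) ^ suc b            ∎) (^-monoˡ-≤ (suc b) m*sx≤2k)

module Bound (d : ℕ) (1≤d : 1 ≤ d) where

  -- `e` is the largest length of a node and `a` bounds the number of variables inside it. The walk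
  -- uses at most about `10 * (c * x) ^ depth` blocks of at most `c * x` elements; one further
  -- factor `x` pays for `10 * c ^ suc depth`, whence `b = 2 + depth` and `threshold`.
  depth e b w a C c threshold : ℕ
  depth     = d * 2
  e         = suc depth
  b         = suc e
  w         = d + d * 2 * d
  a         = suc depth * d + (suc depth * suc depth + suc depth * suc depth)
  C         = b * e + a + 4
  c         = 2 ^ w * C * suc depth + suc (suc depth)
  threshold = suc (10 * c ^ suc depth)

  large-refutation : ∀ m x → threshold ≤ x → x ^ b ≤ suc m → suc m < suc x ^ b →
                     (π : Refutation d (RLNP d (suc m))) → 2 ^ x ≤ Refutation.size π
  large-refutation m x large x^b≤n n<sx^b π = ≮⇒≥ λ size<2^x →
    too-small ≤-refl (power-gap (2 ^ w) (C * x) (length tests) 2≤M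
      (≤-<-trans length-tests (tests-few x b e a size (suc m) B 1≤x (s≤s z≤n) (<⇒≤ size<2^x) n<2^xb B≤n)))
    where
    open Refutation π using (size)
    open import Data.List.Base using (length)
    -- `2 ^ (C * x)` exceeds the number of tests if the size is below `2 ^ x`, so `power-gap`
    -- applies with `u = C * x`.
    t = 2 ^ w * (C * x)
    N = nodeBound (t * depth + suc depth) depth
    B = suc (suc N + 2 * (N + 3))
    1≤x : 1 ≤ x
    1≤x = ≤-trans (s≤s z≤n) large
    2≤M : 2 ≤ 2 ^ w
    2≤M = ^-monoʳ-≤ 2 (≤-trans 1≤d (m≤m+n d (d * 2 * d)))
    1≤t : 1 ≤ t
    1≤t = *-mono-≤ (≤-trans (s≤s z≤n) 2≤M) (*-mono-≤ (≤-trans (s≤s z≤n) (m≤n+m 4 (b * e + a))) 1≤x)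
    Bt≤n : B * t ≤ suc m
    Bt≤n = ≤-trans (blocks-fit (2 ^ w) C depth x 1≤x (≤-trans (n≤1+n _) large)) x^b≤n
    t≤n : t ≤ suc m
    t≤n = ≤-trans (m≤m+n t _) Bt≤n
    B≤n : B ≤ suc m
    B≤n = ≤-trans (m≤m*n B t {{>-nonZero 1≤t}}) Bt≤n
    n<2^xb : suc (suc m) ≤ 2 ^ (x * b)
    n<2^xb = ≤-trans n<sx^b (≤-trans (^-monoˡ-≤ b (suc≤2^ x)) (≤-reflexive (^-*-assoc 2 x b)))
    open Restriction π t B 1≤d t≤n Bt≤n using (tests; length-tests; too-small)

proposition3 : ∀ (d : ℕ) → 1 ≤ d →
    ∃[ ε ] ∃[ c ] 0ℚ <ℚ ε × ε ≤ℚ 1ℚ × 0ℚ <ℚ c ×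
    (∃[ n₀ ] ∀ (n : ℕ) → n₀ ≤ n → (π : Refutation d (RLNP d n)) →
    2^[ c · n ^ ε ]≤ Refutation.size π)
-- `mkℚ` stores the denominator minus one: the exponent is `1 / b`, and the factor `1 / 2` makes up
-- for rounding the `b`-th root of `n` down.
proposition3 d 1≤d = mkℚ (ℤ.+ 1) e (1-coprimeTo _) , mkℚ (ℤ.+ 1) 1 (1-coprimeTo _) ,
  *<* (ℤ.+<+ (s≤s z≤n)) , *≤* (ℤ.+≤+ (s≤s z≤n)) , *<* (ℤ.+<+ (s≤s z≤n)) ,
  threshold ^ b , bound
  where
  open Bound d 1≤d
  bound : ∀ n → threshold ^ b ≤ n → (π : Refutation d (RLNP d n)) →
          2^[ mkℚ (ℤ.+ 1) 1 (1-coprimeTo _) · n ^ mkℚ (ℤ.+ 1) e (1-coprimeTo _) ]≤ Refutation.size π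
  bound zero large = contradiction (m^n>0 threshold b) (≤⇒≯ large)
  bound (suc m) large π k j h with x , lo , hi ← floor-root e (suc m) = begin
    2 ^ k              ≤⟨ ^-monoʳ-≤ 2 (exponent-bound e x (suc m) k j (≤-trans (s≤s z≤n) threshold≤x) hi h) ⟩
    2 ^ (x * j)        ≡⟨ sym (^-*-assoc 2 x j) ⟩
    (2 ^ x) ^ j        ≤⟨ ^-monoˡ-≤ j (large-refutation m x threshold≤x lo hi π) ⟩
    Refutation.size π ^ j ∎
    where
    threshold≤x : threshold ≤ x
    threshold≤x = ≮⇒≥ λ x<threshold → <⇒≱ hi (≤-trans (^-monoˡ-≤ b x<threshold) large)
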